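{- Let $n\ge 1$. The map $\mathrm{orientedruffle}:\mathrm{Ruffle}_n\to \bar S_n$ does the right thing with respect to $\mathrm{hand}$ on $\mathrm{Ruffle}_n$ and the oriented rising number on $\bar S_n$. Consequently the oriented rising number is a lumping of $\bar S_n$: the sums $\sum_{w} w$ over all $w\in\bar S_n$ with a given oriented rising number form a basis of a subalgebra of the group algebra $\mathbf{Q}[\bar S_n]$ (the oriented rising algebra), and this subalgebra is commutative.
   Context: Permutations are composed left to right: $(\sigma\tau)(i)=\tau(\sigma(i))$. $S_n$ is the symmetric group on $\{1,\dots,n\}$; $\sigma(i)$ is the position to which the card originally in position $i$ is moved. $\bar S_n$ is the group of oriented (signed) permutations: bijections $w$ of $\{\pm1,\dots,\pm n\}$ with $w(-i)=-w(i)$, also composed left to right; the card in position $i$ is moved to position $|w(i)|$ and is turned over iff $w(i)<0$. The ruffle monoid $\mathrm{Ruffle}_n$ has as elements the pairs $(a,x)$, with $a\ge1$ an integer and $x=(x_1,\dots,x_n)$ integers, $0\le x_i<a$. Each $(a,x)$ describes an $a$-handed ruffle: let $c_j=\#\{i:x_i=j\}$; hand $j$ ($0\le j<a$) receives the cards $c_0+\dots+c_{j-1}+1,\dots,c_0+\dots+c_j$; the odd-numbered hands are turned over as a bunch (order reversed, each card's orientation flipped); then the hands are interleaved so that the card in final position $i$ comes from hand $x_i$. Thus, in the positions $i$ with $x_i=j$, read in increasing order, the cards of hand $j$ appear in increasing order and unflipped if $j$ is even, and in decreasing order and flipped if $j$ is odd. The resulting oriented permutation is $\mathrm{orientedruffle}(a,x)\in\bar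 S_n$, and $\mathrm{ruffle}(a,x)\in S_n$ is the permutation obtained by ignoring orientations. $S_n$ acts on lists by $(x^\sigma)_{\sigma(i)}=x_i$. The product in $\mathrm{Ruffle}_n$ is $(a,x)*(b,y)=(ab,z)$, where, with $x'=x^{\mathrm{ruffle}(b,y)}$, $z_i=bx'_i+y_i$ if $x'_i$ is even and $z_i=bx'_i+b-1-y_i$ if $x'_i$ is odd. The function $\mathrm{hand}$ on $\mathrm{Ruffle}_n$ is $\mathrm{hand}(a,x)=a$. The oriented rising number of $w\in\bar S_n$ is the minimum $a$ such that $w=\mathrm{orientedruffle}(a,x)$ for some $x$. A function $\mu$ on a monoid $M$ is a lumping if its equivalence classes (level sets) are finite and the class sums form a basis of a subalgebra of $\mathbf{Q}[M]$ (a linear subspace closed under multiplication). Given a lumping $\mu$ of $M$ and a function $\nu$ with finite level sets on a monoid $N$, a monoid homomorphism $f:M\to N$ does the right thing with respect to $\mu$ and $\nu$ if the elements $\sum_{x\in C}f(x)$, $C$ ranging over the $\mu$-classes, belong to and span the subspace of $\mathbf{Q}[N]$ spanned by the class sums of $\nu$. The function $\mathrm{hand}$ is a lumping of $\mathrm{Ruffle}_n$. -}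

module Defs where

open import Algebra.Bundles using (Monoid; Group)
open import Algebra.Morphism.Structures using (IsMonoidHomomorphism)
import Algebra.Properties.CommutativeMonoid.Sum as Sum
open import Data.Bool.Base using (if_then_else_)
open import Data.Empty using (⊥)
open import Data.Fin.Base as Fin using (Fin; toℕ; fromℕ<; combine; opposite; punchOut; finToFun; funToFin)
import Data.Fin.Properties as Fin
open import Data.Fin.Permutation as Perm using (Permutation′; _⟨$⟩ʳ_; _⟨$⟩ˡ_; permutation)
open import Data.List.Base using (List; []; _∷_; _++_; map; foldr; cartesianProductWith)
open import Data.List.Relation.Unary.All using (All)
open import Data.List.Relation.Unary.AllPairs using (AllPairs)
import Data.List.Membership.Setoid as Membership
import Data.List.Relation.Unary.Unique.Setoid as Unique
open import Data.Nat.Base as ℕ using (ℕ; zero; suc; _+_; _*_; _∸_; _^_; _≤_; _<_; z≤n; s≤s; NonZero; parity)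
import Data.Nat.Properties as ℕ
open import Data.Parity.Base as ℙ using (Parity; 0ℙ; 1ℙ; toSign)
import Data.Parity.Properties as ℙ
open import Data.Product.Base using (Σ; Σ-syntax; ∃; _×_; _,_; proj₁; proj₂; map₁; map₂)
open import Data.Rational.Base as ℚ using (ℚ; 0ℚ; 1ℚ)
open import Data.Sign.Base as Sign using (Sign)
import Data.Sign.Properties as Sign
open import Data.Sum.Base using (_⊎_; inj₁; inj₂)
open import Data.Vec.Functional using (Vector)
open import Data.Unit.Base using (tt)
open import Data.Nat.Tactic.RingSolver using (solve-∀)
open import Function.Base using (_∘_)
open import Function.Bundles using (_⇔_; _↔_; _⟶ₛ_; mk⇔; mk↔ₛ′; Func; Inverse; Equivalence)
open import Function.Construct.Composition using (_↔-∘_; _⇔-∘_)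
open import Function.Construct.Identity using (↔-id)
open import Function.Construct.Symmetry using (↔-sym; ⇔-sym)
open import Level using (Level; _⊔_; 0ℓ) renaming (suc to lsuc)
open import Relation.Binary.Bundles using (Setoid)
open import Relation.Binary.Core using (Rel)
open import Relation.Binary.Definitions as B using (tri<; tri≈; tri>)
open import Relation.Binary.PropositionalEquality as ≡ hiding (J; setoid; isEquivalence; decSetoid)
import Relation.Binary.Construct.On as On
open import Relation.Nullary using (¬_; Dec; yes; no; does; contradiction)
open import Relation.Nullary.Decidable using (_×-dec_; map′; does-⇔)
open import Relation.Unary using (Pred; Decidable; _∈_; _⊆_)

-- Decidable equality makes the coefficients of a formal sum computable.
record DecMonoid c ℓ : Set (lsuc (c ⊔ ℓ)) where
  infix 4 _≟_
  field
    monoid : Monoid c ℓ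
    _≟_    : B.Decidable (Monoid._≈_ monoid)
  open Monoid monoid public

module MonoidAlgebra {c ℓ : Level} (M : DecMonoid c ℓ) where
  open DecMonoid M using (Carrier; _≈_; _∙_; _≟_; setoid)

  ℚ[_] : Set c
  ℚ[_] = List (ℚ × Carrier)

  coefficient : ℚ[_] → Carrier → ℚ
  coefficient []            m = 0ℚ
  coefficient ((q , x) ∷ u) m = (if does (x ≟ m) then q else 0ℚ) ℚ.+ coefficient u m

  infix  4 _≋_
  infixl 6 _⊕_
  infixl 7 _⊗_
  infixr 8 _·_

  _≋_ : Rel ℚ[_] c
  u ≋ v = ∀ m → coefficient u m ≡ coefficient v m

  𝟘 : ℚ[_]
  𝟘 = []

  _⊕_ : ℚ[_] → ℚ[_] → ℚ[_]
  _⊕_ = _++_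

  _·_ : ℚ → ℚ[_] → ℚ[_]
  q · u = map (map₁ (q ℚ.*_)) u

  _⊗_ : ℚ[_] → ℚ[_] → ℚ[_]
  _⊗_ = cartesianProductWith λ (p , x) (q , y) → p ℚ.* q , x ∙ y

  linearCombination : ∀ {i} {I : Set i} → (I → ℚ[_]) → List (ℚ × I) → ℚ[_]
  linearCombination b = foldr (λ (q , i) u → q · b i ⊕ u) 𝟘

  Span : ∀ {i} {I : Set i} → (I → ℚ[_]) → Pred ℚ[_] (c ⊔ i)
  Span b u = ∃ λ ts → u ≋ linearCombination b ts

  -- No unit is required: subalgebras here are linear subspaces closed
  -- under multiplication.
  record IsSubalgebra {p} (P : Pred ℚ[_] p) : Set (c ⊔ p) where
    field
      respects : ∀ {u v} → u ≋ v → u ∈ P → v ∈ P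
      𝟘-closed : 𝟘 ∈ P
      ⊕-closed : ∀ {u v} → u ∈ P → v ∈ P → u ⊕ v ∈ P
      ·-closed : ∀ q {u} → u ∈ P → q · u ∈ P
      ⊗-closed : ∀ {u v} → u ∈ P → v ∈ P → u ⊗ v ∈ P

  -- The index set is a setoid because classes will be indexed by their
  -- elements: two indices of the same class are the same index.
  record IsBasis {i ℓᵢ p} (I : Setoid i ℓᵢ) (b : Setoid.Carrier I → ℚ[_])
                 (P : Pred ℚ[_] p) : Set (c ⊔ i ⊔ ℓᵢ ⊔ p) where
    field
      b-cong      : ∀ {j k} → Setoid._≈_ I j k → b j ≋ b k
      belongs     : ∀ j → b j ∈ P
      spans       : P ⊆ Span b
      independent : ∀ (ts : List (ℚ × Setoid.Carrier I)) →
                    AllPairs (λ s t → ¬ Setoid._≈_ I (proj₂ s) (proj₂ t)) ts →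
                    linearCombination b ts ≋ 𝟘 →
                    All (λ t → proj₁ t ≡ 0ℚ) ts

  Commutative : ∀ {p} → Pred ℚ[_] p → Set (c ⊔ p)
  Commutative P = ∀ {u v} → u ∈ P → v ∈ P → u ⊗ v ≋ v ⊗ u

  module _ {v ℓᵥ : Level} {V : Setoid v ℓᵥ} (μ : setoid ⟶ₛ V) where
    open Membership setoid using () renaming (_∈_ to _∈ᴸ_)
    open Unique setoid using () renaming (Unique to Distinct)

    -- The quotient of M by equality of μ; its elements are the classes of μ.
    classes : Setoid c ℓᵥ
    classes = On.setoid V (Func.to μ)

    HasFiniteClasses : Set (c ⊔ ℓ ⊔ ℓᵥ)
    HasFiniteClasses = ∀ x → Σ[ ys ∈ List Carrier ]
      Distinct ys × (∀ y → y ∈ᴸ ys ⇔ Setoid._≈_ classes y x)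

    classSum : HasFiniteClasses → Carrier → ℚ[_]
    classSum finite x = map (1ℚ ,_) (proj₁ (finite x))

    record IsLumping : Set (lsuc c ⊔ ℓ ⊔ ℓᵥ) where
      field
        finite       : HasFiniteClasses
        Subalgebra   : Pred ℚ[_] c
        isSubalgebra : IsSubalgebra Subalgebra
        isBasis      : IsBasis classes (classSum finite) Subalgebra

module _ {c₁ ℓ₁ c₂ ℓ₂ : Level} (M : DecMonoid c₁ ℓ₁) (N : DecMonoid c₂ ℓ₂) where
  private
    module M where
      open DecMonoid M public
      open MonoidAlgebra M public
    module N where
      open DecMonoid N public
      open MonoidAlgebra N public

  image : (M.Carrier → N.Carrier) → M.ℚ[_] → N.ℚ[_]
  image f = map (map₂ f)

  record DoesTheRightThing
    {v₁ k₁ v₂ k₂ : Level} {V : Setoid v₁ k₁} {W : Setoid v₂ k₂}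
    (μ : M.setoid ⟶ₛ V) (ν : N.setoid ⟶ₛ W) (f : M.Carrier → N.Carrier)
    : Set (lsuc c₁ ⊔ ℓ₁ ⊔ c₂ ⊔ ℓ₂ ⊔ k₁ ⊔ k₂) where
    field
      isHomomorphism : IsMonoidHomomorphism M.rawMonoid N.rawMonoid f
      isLumping      : M.IsLumping μ
      finite         : N.HasFiniteClasses ν

    imageSum : M.Carrier → N.ℚ[_]
    imageSum x = image f (M.classSum μ (M.IsLumping.finite isLumping) x)

    field
      belong : ∀ x → imageSum x ∈ N.Span (N.classSum ν finite)
      span   : N.Span (N.classSum ν finite) ⊆ N.Span imageSum

-- {±1, …, ±n}; Fin n is 0-based, so (s , i) stands for s (toℕ i + 1).
±[_] : ℕ → Set
±[ n ] = Sign × Fin n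

neg : ∀ {n} → ±[ n ] → ±[ n ]
neg (s , i) = Sign.opposite s , i

record SignedPermutation (n : ℕ) : Set where
  field
    bijection : ±[ n ] ↔ ±[ n ]
  open Inverse bijection public using (to; from)
  field
    odd : ∀ c → to (neg c) ≡ neg (to c)

  to-from : ∀ c → to (from c) ≡ c
  to-from c = Inverse.inverseˡ bijection refl

  from-to : ∀ c → from (to c) ≡ c
  from-to c = Inverse.inverseʳ bijection refl

  from-odd : ∀ c → from (neg c) ≡ neg (from c)
  from-odd c = begin
    from (neg c)             ≡⟨ cong (from ∘ neg) (to-from c) ⟨
    from (neg (to (from c))) ≡⟨ cong from (odd (from c)) ⟨
    from (to (neg (from c))) ≡⟨ from-to _ ⟩
    neg (from c)             ∎
    where open ≡-Reasoning

open SignedPermutation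

module _ {n : ℕ} where

  infix 4 _≈ₛ_
  infixl 7 _∙ₛ_

  _≈ₛ_ : Rel (SignedPermutation n) 0ℓ
  v ≈ₛ w = ∀ c → to v c ≡ to w c

  _≟ₛ_ : B.Decidable _≈ₛ_
  v ≟ₛ w = map′ (λ (p , q) → λ { (Sign.+ , i) → p i ; (Sign.- , i) → q i })
                (λ h → (λ i → h (Sign.+ , i)) , (λ i → h (Sign.- , i)))
                (agree Sign.+ ×-dec agree Sign.-)
    where
    eq? : B.DecidableEquality ±[ n ]
    eq? (s , i) (t , j) = map′ (λ { (refl , refl) → refl }) (λ { refl → refl , refl })
                               ((s Sign.≟ t) ×-dec (i Fin.≟ j))
    agree : ∀ s → Dec (∀ i → to v (s , i) ≡ to w (s , i))
    agree s = Fin.all? (λ i → eq? (to v (s , i)) (to w (s , i)))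

  -- Composition is left to right.
  _∙ₛ_ : SignedPermutation n → SignedPermutation n → SignedPermutation n
  v ∙ₛ w = record
    { bijection = bijection w ↔-∘ bijection v
    ; odd       = λ c → trans (cong (to w) (odd v c)) (odd w (to v c))
    }

  idₛ : SignedPermutation n
  idₛ = record { bijection = ↔-id _ ; odd = λ _ → refl }

  _⁻¹ₛ : SignedPermutation n → SignedPermutation n
  w ⁻¹ₛ = record { bijection = ↔-sym (bijection w) ; odd = from-odd w }

  ⁻¹ₛ-cong : ∀ {v w} → v ≈ₛ w → v ⁻¹ₛ ≈ₛ w ⁻¹ₛ
  ⁻¹ₛ-cong {v} {w} v≈w c = begin
    from v c               ≡⟨ from-to w (from v c) ⟨
    from w (to w (from v c)) ≡⟨ cong (from w) (v≈w (from v c)) ⟨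
    from w (to v (from v c)) ≡⟨ cong (from w) (to-from v c) ⟩
    from w c               ∎
    where open ≡-Reasoning

  from-split : ∀ (w : SignedPermutation n) s i →
               from w (s , i) ≡ (s Sign.* proj₁ (from w (Sign.+ , i)) , proj₂ (from w (Sign.+ , i)))
  from-split w Sign.+ i = refl
  from-split w Sign.- i = from-odd w (Sign.+ , i)

  -- The permutation i ↦ |w(i)|.
  forgetOrientation : SignedPermutation n → Permutation′ n
  forgetOrientation w = permutation
    (λ i → proj₂ (to w (Sign.+ , i))) (λ i → proj₂ (from w (Sign.+ , i)))
    (λ i → back (w ⁻¹ₛ) i) (back w)
    where
    back : ∀ (v : SignedPermutation n) i →
           proj₂ (from v (Sign.+ , proj₂ (to v (Sign.+ , i)))) ≡ i
    back v i with to v (Sign.+ , i) in eq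
    ... | Sign.+ , j = cong proj₂ (trans (cong (from v) (sym eq)) (from-to v _))
    ... | Sign.- , j = cong proj₂ (trans (from-odd v (Sign.- , j))
                         (cong neg (trans (cong (from v) (sym eq)) (from-to v _))))

signedPermutationGroup : ℕ → Group 0ℓ 0ℓ
signedPermutationGroup n = record
  { Carrier = SignedPermutation n
  ; _≈_     = _≈ₛ_
  ; _∙_     = _∙ₛ_
  ; ε       = idₛ
  ; _⁻¹     = _⁻¹ₛ
  ; isGroup = record
    { isMonoid = record
      { isSemigroup = record
        { isMagma = record
          { isEquivalence = record
            { refl  = λ _ → refl
            ; sym   = λ p c → sym (p c)
            ; trans = λ p q c → trans (p c) (q c)
            }
          ; ∙-cong = λ {v} {v′} {w} {w′} p q c → trans (cong (to w) (p c)) (q (to v′ c))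
          }
        ; assoc = λ _ _ _ _ → refl
        }
      ; identity = (λ _ _ → refl) , (λ _ _ → refl)
      }
    ; inverse = (λ w c → to-from w c) , (λ w c → from-to w c)
    ; ⁻¹-cong = λ {v} {w} → ⁻¹ₛ-cong {v = v} {w}
    }
  }

SignedPermutations : ℕ → DecMonoid 0ℓ 0ℓ
SignedPermutations n = record
  { monoid = Group.monoid (signedPermutationGroup n)
  ; _≟_    = _≟ₛ_
  }

open Sum ℕ.+-0-commutativeMonoid using (sum; sum-cong-≗; sum-permute; sum-replicate-zero; ∑-distrib-+; ∑-comm)

indicator : ∀ {p} {P : Set p} → Dec P → ℕ
indicator P? = if does P? then 1 else 0

infix 10 #_

#_ : ∀ {n p} {P : Pred (Fin n) p} → Decidable P → ℕ
# P? = sum (λ i → indicator (P? i))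

module _ {n : ℕ} {p q} {P : Pred (Fin n) p} {Q : Pred (Fin n) q}
         (P? : Decidable P) (Q? : Decidable Q) where

  #-cong : (∀ i → P i ⇔ Q i) → # P? ≡ # Q?
  #-cong P⇔Q = sum-cong-≗ λ i → cong (if_then 1 else 0) (does-⇔ (P⇔Q i) (P? i) (Q? i))

indicator-mono : ∀ {p q} {P : Set p} {Q : Set q} (P? : Dec P) (Q? : Dec Q) →
                 (P → Q) → indicator P? ≤ indicator Q?
indicator-mono (yes p) (yes q) f = ℕ.≤-refl
indicator-mono (yes p) (no ¬q) f = contradiction (f p) ¬q
indicator-mono (no ¬p) Q?      f = z≤n

#-mono-≤ : ∀ {n p q} {P : Pred (Fin n) p} {Q : Pred (Fin n) q}
           (P? : Decidable P) (Q? : Decidable Q) → (∀ i → P i → Q i) → # P? ≤ # Q?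
#-mono-≤ {zero}  P? Q? f = z≤n
#-mono-≤ {suc n} P? Q? f = ℕ.+-mono-≤ (indicator-mono (P? Fin.zero) (Q? Fin.zero) (f Fin.zero))
  (#-mono-≤ (P? ∘ Fin.suc) (Q? ∘ Fin.suc) (f ∘ Fin.suc))

#-mono-< : ∀ {n p q} {P : Pred (Fin n) p} {Q : Pred (Fin n) q}
           (P? : Decidable P) (Q? : Decidable Q) → (∀ i → P i → Q i) →
           ∀ i → ¬ P i → Q i → # P? < # Q?
#-mono-< P? Q? f Fin.zero ¬p q with P? Fin.zero | Q? Fin.zero
... | yes p | _      = contradiction p ¬p
... | no _  | yes _  = s≤s (#-mono-≤ (P? ∘ Fin.suc) (Q? ∘ Fin.suc) (f ∘ Fin.suc))
... | no _  | no ¬q  = contradiction q ¬q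
#-mono-< P? Q? f (Fin.suc i) ¬p q = ℕ.+-mono-≤-<
  (indicator-mono (P? Fin.zero) (Q? Fin.zero) (f Fin.zero))
  (#-mono-< (P? ∘ Fin.suc) (Q? ∘ Fin.suc) (f ∘ Fin.suc) i ¬p q)

#-⊤ : ∀ n → # (λ (_ : Fin n) → yes tt) ≡ n
#-⊤ zero    = refl
#-⊤ (suc n) = cong suc (#-⊤ n)

#-< : ∀ {n} (i : Fin n) → # (λ (k : Fin n) → k Fin.<? i) ≡ toℕ i
#-< {suc n} Fin.zero    = sum-replicate-zero n
#-< {suc n} (Fin.suc i) = cong suc (#-< i)

rank : ∀ {n} → Vector ℕ n → Fin n → ℕ
rank f i = # (λ k → f k ℕ.<? f i)

module _ {n : ℕ} (f : Vector ℕ n) where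

  rank<n : ∀ i → rank f i < n
  rank<n i = subst (rank f i <_) (#-⊤ n)
    (#-mono-< (λ k → f k ℕ.<? f i) (λ _ → yes tt) (λ _ _ → tt) i (ℕ.<-irrefl refl) tt)

  rank-mono : ∀ {i j} → f i < f j → rank f i < rank f j
  rank-mono {i} {j} i<j = #-mono-< (λ k → f k ℕ.<? f i) (λ k → f k ℕ.<? f j)
    (λ _ k<i → ℕ.<-trans k<i i<j) i (ℕ.<-irrefl refl) i<j

  rank-cancel : ∀ {i j} → rank f i < rank f j → f i < f j
  rank-cancel {i} {j} r with ℕ.<-cmp (f i) (f j)
  ... | tri< lt _ _ = lt
  ... | tri≈ _ eq _ = contradiction r (ℕ.<-irrefl
        (cong (λ v → # (λ k → f k ℕ.<? v)) eq))
  ... | tri> _ _ gt = contradiction r (ℕ.<-asym (rank-mono gt))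

  rank-injective : (∀ {i j} → f i ≡ f j → i ≡ j) → ∀ {i j} → rank f i ≡ rank f j → i ≡ j
  rank-injective inj {i} {j} eq with ℕ.<-cmp (f i) (f j)
  ... | tri< lt _ _ = contradiction (rank-mono lt) (ℕ.<-irrefl eq)
  ... | tri≈ _ e _  = inj e
  ... | tri> _ _ gt = contradiction (rank-mono gt) (ℕ.<-irrefl (sym eq))

rank-cong : ∀ {n} (f g : Vector ℕ n) → (∀ i → f i ≡ g i) → ∀ i → rank f i ≡ rank g i
rank-cong f g eq i = #-cong (λ k → f k ℕ.<? f i) (λ k → g k ℕ.<? g i) λ k → mk⇔ (subst₂ _<_ (eq k) (eq i))
                                          (subst₂ _<_ (sym (eq k)) (sym (eq i)))

injective⇒permutation : ∀ {n} (f : Fin n → Fin n) → (∀ {i j} → f i ≡ f j → i ≡ j) → Permutation′ n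
injective⇒permutation {n} f inj = permutation f (proj₁ ∘ preimage) (proj₂ ∘ preimage)
  (λ i → inj (proj₂ (preimage (f i))))
  where
  onto : ∀ {n} (f : Fin n → Fin n) → (∀ {i j} → f i ≡ f j → i ≡ j) → ∀ j → Dec (∃ λ i → f i ≡ j) → ∃ λ i → f i ≡ j
  onto f inj j (yes h) = h
  onto {suc n} f inj j (no ¬h) = contradiction
    (Fin.injective⇒≤ {f = λ i → punchOut (j≢ i)} λ {i} {k} eq → inj (Fin.punchOut-injective (j≢ i) (j≢ k) eq))
    (ℕ.<-irrefl refl)
    where
    j≢ : ∀ i → j ≢ f i
    j≢ i eq = ¬h (i , sym eq)
  preimage : ∀ j → ∃ λ i → f i ≡ j
  preimage j = onto f inj j (Fin.any? (λ i → f i Fin.≟ j))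

orient : ∀ {n} → Parity → Fin n → Fin n
orient 0ℙ i = i
orient 1ℙ i = opposite i

-- With 0 ≤ j < a and 0 ≤ i < b: the number b j + i if j is even, and
-- b j + (b - 1 - i) if j is odd.
infixr 7 _⊛_

_⊛_ : ∀ {a b} → Fin a → Fin b → Fin (a * b)
j ⊛ i = combine j (orient (parity (toℕ j)) i)

Before : ∀ {n} → Parity → Rel (Fin n) 0ℓ
Before 0ℙ k i = k Fin.< i
Before 1ℙ k i = i Fin.< k

before? : ∀ {n} π → B.Decidable (Before {n} π)
before? 0ℙ k i = k Fin.<? i
before? 1ℙ k i = i Fin.<? k

module _ {a n : ℕ} (x : Vector (Fin a) n) where

  -- c_j
  handSize : ℕ → ℕ
  handSize j = # (λ i → toℕ (x i) ℕ.≟ j)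

  -- c_0 + … + c_{j-1}
  handStart : ℕ → ℕ
  handStart j = sum (λ (k : Fin j) → handSize (toℕ k))

  -- The number of cards of hand x i lying above the card in final position
  -- i before the hand is (possibly) turned over: an odd hand is turned over,
  -- so those are the cards of the hand that end up below position i.
  placeInHand : Fin n → ℕ
  placeInHand i = # (λ k → (x k Fin.≟ x i) ×-dec before? (parity (toℕ (x i))) k i)

  -- The original (0-based) position of the card in final position i.
  origin : Fin n → ℕ
  origin i = handStart (toℕ (x i)) + placeInHand i

  -- Ordering the final positions by key orders the cards by their original
  -- positions, see origin≡rank.
  key : Vector ℕ n
  key i = toℕ (x i ⊛ i)

opposite-sum : ∀ {n} (i : Fin n) → suc (toℕ i + toℕ (opposite i)) ≡ n
opposite-sum {n} i = trans (cong (λ v → suc (toℕ i + v)) (Fin.opposite-prop i)) (ℕ.m+[n∸m]≡n (Fin.toℕ<n i))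

orient-< : ∀ {n} π (k i : Fin n) → toℕ (orient π k) < toℕ (orient π i) ⇔ Before π k i
orient-< 0ℙ k i = mk⇔ (λ h → h) (λ h → h)
orient-< {n} 1ℙ k i rewrite Fin.opposite-prop k | Fin.opposite-prop i = mk⇔
  (λ h → ℕ.≰⇒> (λ k≤i → ℕ.<⇒≱ h (ℕ.∸-monoʳ-≤ n (s≤s k≤i))))
  (λ h → ℕ.∸-monoʳ-< (s≤s h) (Fin.toℕ<n k))

orient-injective : ∀ {n} π {k i : Fin n} → orient π k ≡ orient π i → k ≡ i
orient-injective 0ℙ eq = eq
orient-injective 1ℙ {k} {i} eq = trans (sym (Fin.opposite-involutive k))
  (trans (cong opposite eq) (Fin.opposite-involutive i))

orient-+ : ∀ {n} π ρ (i : Fin n) → orient (π ℙ.+ ρ) i ≡ orient π (orient ρ i)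
orient-+ 0ℙ ρ  i = refl
orient-+ 1ℙ 0ℙ i = refl
orient-+ 1ℙ 1ℙ i = sym (Fin.opposite-involutive i)

orient-combine : ∀ {a b} π (j : Fin a) (i : Fin b) →
                 orient π (combine j i) ≡ combine (orient π j) (orient π i)
orient-combine 0ℙ j i = refl
orient-combine {a} {b} 1ℙ j i = Fin.toℕ-injective (ℕ.+-cancelˡ-≡ (suc (toℕ (combine j i))) _ _ (begin
  suc (toℕ (combine j i)) + toℕ (opposite (combine j i)) ≡⟨ opposite-sum (combine j i) ⟩
  a * b                                                  ≡⟨ ℕ.*-comm a b ⟩
  b * a                                                  ≡⟨ cong (b *_) (opposite-sum j) ⟨
  b * suc (J + J′)                                       ≡⟨ rearr b J J′ ⟩
  b * J + b * J′ + b                                     ≡⟨ cong (b * J + b * J′ +_) (opposite-sum i) ⟨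
  b * J + b * J′ + suc (I + I′)                          ≡⟨ rearr′ (b * J) (b * J′) I I′ ⟩
  suc (b * J + I) + (b * J′ + I′)                        ≡⟨ cong₂ (λ s t → suc s + t) (Fin.toℕ-combine j i)
                                                              (Fin.toℕ-combine (opposite j) (opposite i)) ⟨
  suc (toℕ (combine j i)) + toℕ (combine (opposite j) (opposite i)) ∎))
  where
  open ≡-Reasoning
  J = toℕ j
  I = toℕ i
  J′ = toℕ (opposite j)
  I′ = toℕ (opposite i)
  rearr : ∀ b s t → b * suc (s + t) ≡ b * s + b * t + b
  rearr = solve-∀
  rearr′ : ∀ s t u v → s + t + suc (u + v) ≡ suc (s + u) + (t + v)
  rearr′ = solve-∀

toℕ-orient : ∀ {n} π (i : Fin n) → parity (toℕ (orient π i)) ≡ parity (toℕ i) ℙ.+ (π ℙ.* parity (suc n))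
toℕ-orient 0ℙ i = sym (ℙ.+-identityʳ _)
toℕ-orient {n} 1ℙ i = begin
  parity I′                        ≡⟨ p+p I I′ ⟩
  parity I ℙ.+ parity (I + I′)     ≡⟨ cong (λ v → parity I ℙ.+ parity (suc v)) (opposite-sum i) ⟩
  parity I ℙ.+ parity (suc n)      ∎
  where
  open ≡-Reasoning
  I = toℕ i
  I′ = toℕ (opposite i)
  p+p : ∀ s t → parity t ≡ parity s ℙ.+ parity (s + t)
  p+p s t rewrite ℙ.+-homo-+ s t with parity s
  ... | 0ℙ = refl
  ... | 1ℙ = sym (ℙ.⁻¹-involutive (parity t))

parity-⊛ : ∀ {a b} (j : Fin a) (i : Fin b) →
           parity (toℕ (j ⊛ i)) ≡ parity (toℕ j) ℙ.+ parity (toℕ i)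
parity-⊛ {a} {b} j i = begin
  parity (toℕ (j ⊛ i))                                ≡⟨ cong parity (Fin.toℕ-combine j _) ⟩
  parity (b * toℕ j + toℕ (orient π i))               ≡⟨ ℙ.+-homo-+ (b * toℕ j) _ ⟩
  parity (b * toℕ j) ℙ.+ parity (toℕ (orient π i))    ≡⟨ cong₂ ℙ._+_ (ℙ.*-homo-* b (toℕ j)) (toℕ-orient π i) ⟩
  (parity b ℙ.* π) ℙ.+ (parity (toℕ i) ℙ.+ (π ℙ.* parity (suc b)))
    ≡⟨ cong (λ v → (parity b ℙ.* π) ℙ.+ (parity (toℕ i) ℙ.+ (π ℙ.* v))) (sym (ℙ.suc-homo-⁻¹ (suc b))) ⟩
  (parity b ℙ.* π) ℙ.+ (parity (toℕ i) ℙ.+ (π ℙ.* parity b ℙ.⁻¹)) ≡⟨ table (parity b) π (parity (toℕ i)) ⟩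
  π ℙ.+ parity (toℕ i)                                ∎
  where
  open ≡-Reasoning
  π = parity (toℕ j)
  table : ∀ β π ι → (β ℙ.* π) ℙ.+ (ι ℙ.+ (π ℙ.* β ℙ.⁻¹)) ≡ π ℙ.+ ι
  table 0ℙ 0ℙ 0ℙ = refl
  table 0ℙ 0ℙ 1ℙ = refl
  table 0ℙ 1ℙ 0ℙ = refl
  table 0ℙ 1ℙ 1ℙ = refl
  table 1ℙ 0ℙ 0ℙ = refl
  table 1ℙ 0ℙ 1ℙ = refl
  table 1ℙ 1ℙ 0ℙ = refl
  table 1ℙ 1ℙ 1ℙ = refl

⊛-cong : ∀ {a a′ b b′} {j : Fin a} {j′ : Fin a′} {i : Fin b} {i′ : Fin b′} →
         b ≡ b′ → toℕ j ≡ toℕ j′ → toℕ i ≡ toℕ i′ → toℕ (j ⊛ i) ≡ toℕ (j′ ⊛ i′)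
⊛-cong {b = b} {j = j} {j′} {i} {i′} refl ej ei with Fin.toℕ-injective {i = i} {i′} ei
... | refl = begin
  toℕ (j ⊛ i)                                          ≡⟨ Fin.toℕ-combine j _ ⟩
  b * toℕ j + toℕ (orient (parity (toℕ j)) i)          ≡⟨ cong (λ v → b * v + toℕ (orient (parity v) i)) ej ⟩
  b * toℕ j′ + toℕ (orient (parity (toℕ j′)) i)        ≡⟨ Fin.toℕ-combine j′ _ ⟨
  toℕ (j′ ⊛ i)                                         ∎
  where open ≡-Reasoning

⊛-assoc : ∀ {a b c} (j : Fin a) (i : Fin b) (h : Fin c) →
          toℕ ((j ⊛ i) ⊛ h) ≡ toℕ (j ⊛ (i ⊛ h))
⊛-assoc {a} {b} {c} j i h = begin
  toℕ ((j ⊛ i) ⊛ h)                                         ≡⟨ Fin.toℕ-combine (j ⊛ i) _ ⟩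
  c * toℕ (j ⊛ i) + toℕ (orient (parity (toℕ (j ⊛ i))) h)   ≡⟨ cong₂ (λ s t → c * s + toℕ (orient t h)) (Fin.toℕ-combine j _) (parity-⊛ j i) ⟩
  c * (b * toℕ j + toℕ (orient π i)) + toℕ (orient (π ℙ.+ ρ) h) ≡⟨ cong (λ t → c * (b * toℕ j + toℕ (orient π i)) + toℕ t) (orient-+ π ρ h) ⟩
  c * (b * toℕ j + toℕ (orient π i)) + toℕ (orient π (orient ρ h)) ≡⟨ rearr b c (toℕ j) (toℕ (orient π i)) _ ⟩
  (b * c) * toℕ j + (c * toℕ (orient π i) + toℕ (orient π (orient ρ h))) ≡⟨ cong ((b * c) * toℕ j +_) (Fin.toℕ-combine (orient π i) (orient π (orient ρ h))) ⟨
  (b * c) * toℕ j + toℕ (combine (orient π i) (orient π (orient ρ h))) ≡⟨ cong (λ t → (b * c) * toℕ j + toℕ t) (orient-combine π i (orient ρ h)) ⟨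
  (b * c) * toℕ j + toℕ (orient π (i ⊛ h))                 ≡⟨ Fin.toℕ-combine j _ ⟨
  toℕ (j ⊛ (i ⊛ h))                                         ∎
  where
  open ≡-Reasoning
  π = parity (toℕ j)
  ρ = parity (toℕ i)
  rearr : ∀ b c j u v → c * (b * j + u) + v ≡ (b * c) * j + (c * u + v)
  rearr = solve-∀

⊛-injectiveʳ : ∀ {a b} {j j′ : Fin a} {i i′ : Fin b} → toℕ (j ⊛ i) ≡ toℕ (j′ ⊛ i′) → i ≡ i′
⊛-injectiveʳ {j = j} {j′} eq with Fin.combine-injective j _ j′ _ (Fin.toℕ-injective eq)
... | refl , e = orient-injective (parity (toℕ j)) e

⊛-< : ∀ {a b} (j j′ : Fin a) (i i′ : Fin b) →
      toℕ (j ⊛ i) < toℕ (j′ ⊛ i′) ⇔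
      (toℕ j < toℕ j′ ⊎ (j ≡ j′ × Before (parity (toℕ j′)) i i′))
⊛-< {a} {b} j j′ i i′ = mk⇔ ⇒ ⇐
  where
  ⇐ : _ → toℕ (j ⊛ i) < toℕ (j′ ⊛ i′)
  ⇐ (inj₁ lt) = Fin.combine-monoˡ-< _ _ lt
  ⇐ (inj₂ (refl , h)) = subst₂ _<_ (sym (Fin.toℕ-combine j _)) (sym (Fin.toℕ-combine j _))
    (ℕ.+-monoʳ-< (b * toℕ j) (Equivalence.from (orient-< (parity (toℕ j)) i i′) h))
  ⇒ : toℕ (j ⊛ i) < toℕ (j′ ⊛ i′) → _
  ⇒ lt with Fin.<-cmp j j′
  ... | tri< l _ _ = inj₁ l
  ... | tri≈ _ refl _ = inj₂ (refl , Equivalence.to (orient-< (parity (toℕ j)) i i′)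
        (ℕ.+-cancelˡ-< (b * toℕ j) _ _ (subst₂ _<_ (Fin.toℕ-combine j _) (Fin.toℕ-combine j _) lt)))
  ... | tri> _ _ g = contradiction lt (ℕ.<-asym (Fin.combine-monoˡ-< _ _ g))

indicator-⊎ : ∀ {p q r} {P : Set p} {Q : Set q} {R : Set r} (P? : Dec P) (Q? : Dec Q) (R? : Dec R) →
              (P → Q → ⊥) → R ⇔ (P ⊎ Q) → indicator P? + indicator Q? ≡ indicator R?
indicator-⊎ (yes p) (yes q) R?       dis e = contradiction q (dis p)
indicator-⊎ (yes p) (no ¬q) (yes r)  dis e = refl
indicator-⊎ (yes p) (no ¬q) (no ¬r)  dis e = contradiction (Equivalence.from e (inj₁ p)) ¬r
indicator-⊎ (no ¬p) (yes q) (yes r)  dis e = refl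
indicator-⊎ (no ¬p) (yes q) (no ¬r)  dis e = contradiction (Equivalence.from e (inj₂ q)) ¬r
indicator-⊎ (no ¬p) (no ¬q) (no ¬r)  dis e = refl
indicator-⊎ (no ¬p) (no ¬q) (yes r)  dis e with Equivalence.to e r
... | inj₁ p = contradiction p ¬p
... | inj₂ q = contradiction q ¬q

module _ {a n : ℕ} (x : Vector (Fin a) n) where

  handStart-# : ∀ j → handStart x j ≡ # (λ i → toℕ (x i) ℕ.<? j)
  handStart-# j = trans (∑-comm (λ (k : Fin j) i → indicator (toℕ (x i) ℕ.≟ toℕ k)))
                        (sum-cong-≗ (λ i → column (toℕ (x i)) j))
    where
    column : ∀ v j → sum (λ (k : Fin j) → indicator (v ℕ.≟ toℕ k)) ≡ indicator (v ℕ.<? j)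
    column v       zero    = refl
    column zero    (suc j) = cong suc (sum-replicate-zero j)
    column (suc v) (suc j) = column v j

  origin≡rank : ∀ i → origin x i ≡ rank (key x) i
  origin≡rank i = begin
    handStart x (toℕ (x i)) + placeInHand x i              ≡⟨ cong (_+ placeInHand x i) (handStart-# (toℕ (x i))) ⟩
    # (λ k → toℕ (x k) ℕ.<? toℕ (x i)) + placeInHand x i   ≡⟨ ∑-distrib-+ {n} (λ k → indicator (toℕ (x k) ℕ.<? toℕ (x i))) _ ⟨
    _                                                      ≡⟨ sum-cong-≗ (λ k → indicator-⊎
        (toℕ (x k) ℕ.<? toℕ (x i))
        ((x k Fin.≟ x i) ×-dec before? (parity (toℕ (x i))) k i)
        (key x k ℕ.<? key x i)
        (λ lt (eq , _) → ℕ.<-irrefl (cong toℕ eq) lt)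
        (⊛-< (x k) (x i) k i)) ⟩
    rank (key x) i                                         ∎
    where open ≡-Reasoning

  origin<n : ∀ i → origin x i < n
  origin<n i = subst (_< n) (sym (origin≡rank i)) (rank<n (key x) i)

  originPermutation : Permutation′ n
  originPermutation = injective⇒permutation (λ i → fromℕ< (origin<n i)) λ {i} {j} eq →
    rank-injective (key x) (λ {k} {l} → ⊛-injectiveʳ {j = x k} {x l})
      (trans (sym (origin≡rank i))
        (trans (Fin.fromℕ<-injective _ _ (origin<n i) (origin<n j) eq) (origin≡rank j)))

  toℕ-originPermutation : ∀ i → toℕ (originPermutation ⟨$⟩ʳ i) ≡ rank (key x) i
  toℕ-originPermutation i = trans (Fin.toℕ-fromℕ< (origin<n i)) (origin≡rank i)

-- The signed permutation taking position p to position i with sign s i,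
-- where p is the image of i under π.
fromOrigins : ∀ {n} → Permutation′ n → Vector Sign n → SignedPermutation n
fromOrigins π s = record
  { bijection = mk↔ₛ′
      (λ (t , p) → t Sign.* s (π ⟨$⟩ˡ p) , π ⟨$⟩ˡ p)
      (λ (t , i) → t Sign.* s i , π ⟨$⟩ʳ i)
      (λ (t , i) → cong₂ _,_
        (trans (cong (λ k → t Sign.* s i Sign.* s k) (Perm.inverseˡ π)) (twice t (s i)))
        (Perm.inverseˡ π))
      (λ (t , p) → cong₂ _,_ (twice t _) (Perm.inverseʳ π))
  ; odd = λ (t , p) → cong (_, π ⟨$⟩ˡ p) (opposite-* t _)
  }
  where
  twice : ∀ t u → t Sign.* u Sign.* u ≡ t
  twice t u = trans (Sign.*-assoc t u u) (trans (cong (t Sign.*_) (Sign.s*s≡+ u)) (Sign.*-identityʳ t))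
  opposite-* : ∀ t u → Sign.opposite t Sign.* u ≡ Sign.opposite (t Sign.* u)
  opposite-* Sign.+ u = refl
  opposite-* Sign.- u = sym (Sign.opposite-selfInverse refl)

record Ruffling (n : ℕ) : Set where
  constructor ruffling
  field
    hands           : ℕ
    .{{hands≢0}}    : NonZero hands
    handOf          : Vector (Fin hands) n

open Ruffling using (hands; handOf)

module _ {n : ℕ} where

  infix  4 _≈ᵣ_ _≟ᵣ_
  infixl 7 _∙ᵣ_
  infixl 8 _▷_

  _≈ᵣ_ : Rel (Ruffling n) 0ℓ
  r ≈ᵣ s = hands r ≡ hands s × (∀ i → toℕ (handOf r i) ≡ toℕ (handOf s i))

  _≟ᵣ_ : B.Decidable _≈ᵣ_
  r ≟ᵣ s = (hands r ℕ.≟ hands s) ×-dec Fin.all? (λ i → toℕ (handOf r i) ℕ.≟ toℕ (handOf s i))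

  -- The cards of the odd-numbered hands are flipped.
  orientedRuffle : Ruffling n → SignedPermutation n
  orientedRuffle (ruffling a x) =
    fromOrigins (originPermutation x) (λ i → toSign (parity (toℕ (x i))))

  ruffle : Ruffling n → Permutation′ n
  ruffle r = forgetOrientation (orientedRuffle r)

  -- x ▷ σ is x^σ, determined by (x^σ)_{σ(i)} = x_i.
  _▷_ : ∀ {A : Set} → Vector A n → Permutation′ n → Vector A n
  (x ▷ σ) i = x (σ ⟨$⟩ˡ i)

  _∙ᵣ_ : Ruffling n → Ruffling n → Ruffling n
  ruffling a x ∙ᵣ r@(ruffling b y) =
    ruffling (a * b) {{ℕ.m*n≢0 a b}} (λ i → (x ▷ ruffle r) i ⊛ y i)

  εᵣ : Ruffling n
  εᵣ = ruffling 1 (λ _ → Fin.zero)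

  originᵣ : Ruffling n → Fin n → Fin n
  originᵣ r i = originPermutation (handOf r) ⟨$⟩ʳ i

  toℕ-originᵣ : ∀ r i → toℕ (originᵣ r i) ≡ rank (key (handOf r)) i
  toℕ-originᵣ r = toℕ-originPermutation (handOf r)

  originᵣ-cong : ∀ r s → r ≈ᵣ s → ∀ i → originᵣ r i ≡ originᵣ s i
  originᵣ-cong r s (_ , eq) i = Fin.toℕ-injective (trans (toℕ-originᵣ r i)
    (trans (rank-cong (key (handOf r)) (key (handOf s)) (λ k → ⊛-cong refl (eq k) refl) i) (sym (toℕ-originᵣ s i))))

  originᵣ-< : ∀ r {k i} → toℕ (originᵣ r k) < toℕ (originᵣ r i) ⇔ key (handOf r) k < key (handOf r) i
  originᵣ-< r {k} {i} = mk⇔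
    (λ lt → rank-cancel (key (handOf r)) (subst₂ _<_ (toℕ-originᵣ r k) (toℕ-originᵣ r i) lt))
    (λ lt → subst₂ _<_ (sym (toℕ-originᵣ r k)) (sym (toℕ-originᵣ r i)) (rank-mono (key (handOf r)) lt))

  originᵣ-∙ : ∀ r s i → originᵣ (r ∙ᵣ s) i ≡ originᵣ r (originᵣ s i)
  originᵣ-∙ r@(ruffling a x) s@(ruffling b y) i = Fin.toℕ-injective (begin
    toℕ (originᵣ (r ∙ᵣ s) i)                                ≡⟨ toℕ-originᵣ (r ∙ᵣ s) i ⟩
    rank (key (handOf (r ∙ᵣ s))) i                    ≡⟨ #-cong (λ k → key (handOf (r ∙ᵣ s)) k ℕ.<? key (handOf (r ∙ᵣ s)) i)
                                                                 (λ k → key x (originᵣ s k) ℕ.<? key x (originᵣ s i)) step ⟩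
    # (λ k → key x (originᵣ s k) ℕ.<? key x (originᵣ s i))        ≡⟨ sum-permute (λ k → indicator (key x k ℕ.<? key x (originᵣ s i))) (originPermutation y) ⟨
    rank (key x) (originᵣ s i)                              ≡⟨ toℕ-originᵣ r (originᵣ s i) ⟨
    toℕ (originᵣ r (originᵣ s i))                                 ∎)
    where
    open ≡-Reasoning
    before⇔ : ∀ π k → Before π (y k ⊛ k) (y i ⊛ i) ⇔ Before π (originᵣ s k) (originᵣ s i)
    before⇔ 0ℙ k = ⇔-sym (originᵣ-< s)
    before⇔ 1ℙ k = ⇔-sym (originᵣ-< s)
    step : ∀ k → key (handOf (r ∙ᵣ s)) k < key (handOf (r ∙ᵣ s)) i ⇔ key x (originᵣ s k) < key x (originᵣ s i)
    step k = mk⇔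
      (λ lt → Equivalence.from (⊛-< (x (originᵣ s k)) (x (originᵣ s i)) (originᵣ s k) (originᵣ s i))
        (fwd (Equivalence.to (⊛-< (x (originᵣ s k)) (x (originᵣ s i)) (y k ⊛ k) (y i ⊛ i))
          (subst₂ _<_ (⊛-assoc (x (originᵣ s k)) (y k) k) (⊛-assoc (x (originᵣ s i)) (y i) i) lt))))
      (λ lt → subst₂ _<_ (sym (⊛-assoc (x (originᵣ s k)) (y k) k)) (sym (⊛-assoc (x (originᵣ s i)) (y i) i))
        (Equivalence.from (⊛-< (x (originᵣ s k)) (x (originᵣ s i)) (y k ⊛ k) (y i ⊛ i))
          (bwd (Equivalence.to (⊛-< (x (originᵣ s k)) (x (originᵣ s i)) (originᵣ s k) (originᵣ s i)) lt))))
      where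
      fwd : _ ⊎ _ → _ ⊎ _
      fwd (inj₁ l)       = inj₁ l
      fwd (inj₂ (e , h)) = inj₂ (e , Equivalence.to (before⇔ (parity (toℕ (x (originᵣ s i)))) k) h)
      bwd : _ ⊎ _ → _ ⊎ _
      bwd (inj₁ l)       = inj₁ l
      bwd (inj₂ (e , h)) = inj₂ (e , Equivalence.from (before⇔ (parity (toℕ (x (originᵣ s i)))) k) h)

  originᵣ-ε : ∀ i → originᵣ εᵣ i ≡ i
  originᵣ-ε i = Fin.toℕ-injective (trans (Fin.toℕ-fromℕ< (origin<n (handOf εᵣ) i)) (#-< i))

  ∙ᵣ-cong : ∀ {r r′ s s′} → r ≈ᵣ r′ → s ≈ᵣ s′ → r ∙ᵣ s ≈ᵣ r′ ∙ᵣ s′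
  ∙ᵣ-cong {r} {r′} {s} {s′} (ea , ex) q@(eb , ey) = cong₂ _*_ ea eb ,
    λ i → ⊛-cong eb (trans (cong (toℕ ∘ handOf r) (originᵣ-cong s s′ q i)) (ex (originᵣ s′ i))) (ey i)

  ∙ᵣ-assoc : ∀ r s t → (r ∙ᵣ s) ∙ᵣ t ≈ᵣ r ∙ᵣ (s ∙ᵣ t)
  ∙ᵣ-assoc r@(ruffling a x) s@(ruffling b y) t@(ruffling c z) = ℕ.*-assoc a b c ,
    λ i → trans (⊛-assoc (x (originᵣ s (originᵣ t i))) (y (originᵣ t i)) (z i))
                (⊛-cong refl (cong (toℕ ∘ x) (sym (originᵣ-∙ s t i))) refl)

  ∙ᵣ-identityˡ : ∀ r → εᵣ ∙ᵣ r ≈ᵣ r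
  ∙ᵣ-identityˡ (ruffling a x) = ℕ.*-identityˡ a , λ i → trans (Fin.toℕ-combine {1} Fin.zero (x i)) (cong (_+ toℕ (x i)) (ℕ.*-zeroʳ a))

  ∙ᵣ-identityʳ : ∀ r → r ∙ᵣ εᵣ ≈ᵣ r
  ∙ᵣ-identityʳ r@(ruffling a x) = ℕ.*-identityʳ a , λ i → begin
    toℕ (x (originᵣ εᵣ i) ⊛ Fin.zero {0})      ≡⟨ Fin.toℕ-combine (x (originᵣ εᵣ i)) _ ⟩
    1 * toℕ (x (originᵣ εᵣ i)) + toℕ (orient (parity (toℕ (x (originᵣ εᵣ i)))) (Fin.zero {0})) ≡⟨ cong₂ (λ v w → 1 * toℕ (x v) + w) (originᵣ-ε i) (Fin1 (orient (parity (toℕ (x (originᵣ εᵣ i)))) (Fin.zero {0}))) ⟩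
    1 * toℕ (x i) + 0                    ≡⟨ ℕ.+-identityʳ _ ⟩
    1 * toℕ (x i)                        ≡⟨ ℕ.*-identityˡ _ ⟩
    toℕ (x i)                            ∎
    where
    open ≡-Reasoning
    Fin1 : (i : Fin 1) → toℕ i ≡ 0
    Fin1 Fin.zero = refl

  orientedRuffle-cong : ∀ {r s} → r ≈ᵣ s → orientedRuffle r ≈ₛ orientedRuffle s
  orientedRuffle-cong {r} {s} eq = ⁻¹ₛ-cong {v = orientedRuffle r ⁻¹ₛ} {orientedRuffle s ⁻¹ₛ} λ (t , i) →
    cong₂ _,_ (cong (λ v → t Sign.* toSign (parity v)) (proj₂ eq i)) (originᵣ-cong r s eq i)

Ruffles : ℕ → DecMonoid 0ℓ 0ℓ
Ruffles n = record
  { monoid = record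
    { Carrier  = Ruffling n
    ; _≈_      = _≈ᵣ_
    ; _∙_      = _∙ᵣ_
    ; ε        = εᵣ
    ; isMonoid = record
      { isSemigroup = record
        { isMagma = record
          { isEquivalence = record
            { refl  = refl , λ _ → refl
            ; sym   = λ (p , q) → sym p , λ i → sym (q i)
            ; trans = λ (p , q) (p′ , q′) → trans p p′ , λ i → trans (q i) (q′ i)
            }
          ; ∙-cong = λ {r} {r′} {s} {s′} → ∙ᵣ-cong {r = r} {r′} {s} {s′}
          }
        ; assoc = ∙ᵣ-assoc
        }
      ; identity = ∙ᵣ-identityˡ , ∙ᵣ-identityʳ
      }
    }
  ; _≟_ = _≟ᵣ_
  }

hand : ∀ n → DecMonoid.setoid (Ruffles n) ⟶ₛ ≡.setoid ℕ
hand n = record { to = hands ; cong = proj₁ }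

IsMinimum : ∀ {p} → Pred ℕ p → ℕ → Set p
IsMinimum P a = P a × (∀ b → P b → a ≤ b)

minimum : ∀ {p} {P : Pred ℕ p} → Decidable P → ∃ P → ∃ (IsMinimum P)
minimum {P = P} P? (m , p) = search m 0 (subst P (sym (ℕ.+-identityʳ m)) p) (λ _ ())
  where
  search : ∀ k l → P (k + l) → (∀ b → b < l → ¬ P b) → ∃ (IsMinimum P)
  search k l p below with P? l
  ... | yes pl = l , pl , λ b pb → ℕ.≮⇒≥ (λ b<l → below b b<l pb)
  search zero    l p below | no ¬pl = contradiction p ¬pl
  search (suc k) l p below | no ¬pl = search k (suc l) (subst P (sym (ℕ.+-suc k l)) p) below′
    where
    below′ : ∀ b → b < suc l → ¬ P b
    below′ b b<1+l pb with ℕ.m<1+n⇒m<n∨m≡n b<1+l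
    ... | inj₁ b<l  = below b b<l pb
    ... | inj₂ refl = ¬pl pb

module _ {n : ℕ} where

  IsRuffleWith : SignedPermutation n → Pred ℕ 0ℓ
  IsRuffleWith w a = Σ[ r ∈ Ruffling n ] hands r ≡ a × w ≈ₛ orientedRuffle r

  isRuffleWith? : ∀ w → Decidable (IsRuffleWith w)
  isRuffleWith? w zero = no λ { (r@(ruffling zero {{()}} _) , refl , _) }
  isRuffleWith? w (suc a) = map′
    (λ (f , eq) → mk f , refl , eq)
    (λ { (r@(ruffling _ x) , refl , eq) → funToFin x , λ c → trans (eq c)
           (orientedRuffle-cong {r = r} {mk (funToFin x)} (refl , λ i → cong toℕ (sym (Fin.finToFun-funToFin x i))) c) })
    (Fin.any? (λ f → w ≟ₛ orientedRuffle (mk f)))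
    where
    mk : Fin (suc a ^ n) → Ruffling n
    mk f = ruffling (suc a) (finToFun f)

-- Taking the card in position p (0-based) as the only card of hand 2p or 2p + 1, whichever has the right
-- parity, shows that every w is an oriented 2n-ruffle if n > 0.
dealOneByOne : ∀ {n} .{{_ : NonZero (n * 2)}} (w : SignedPermutation n) → IsRuffleWith w (n * 2)
dealOneByOne {n} w = r , refl , ⁻¹ₛ-cong {v = w ⁻¹ₛ} {orientedRuffle r ⁻¹ₛ} eq
  where
  open ≡-Reasoning
  π : Permutation′ n
  π = Perm.flip (forgetOrientation w)
  bit : Sign → Fin 2
  bit Sign.+ = Fin.zero
  bit Sign.- = Fin.suc Fin.zero
  sign : Fin n → Sign
  sign i = proj₁ (from w (Sign.+ , i))
  x : Vector (Fin (n * 2)) n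
  x i = combine (π ⟨$⟩ʳ i) (bit (sign i))
  r : Ruffling n
  r = ruffling (n * 2) x
  π-injective : ∀ {k i} → π ⟨$⟩ʳ k ≡ π ⟨$⟩ʳ i → k ≡ i
  π-injective e = trans (sym (Perm.inverseˡ π)) (trans (cong (π ⟨$⟩ˡ_) e) (Perm.inverseˡ π))
  ordered : ∀ k i → key x k < key x i ⇔ (π ⟨$⟩ʳ k) Fin.< (π ⟨$⟩ʳ i)
  ordered k i = mk⇔ ⇒ (λ lt → Equivalence.from (⊛-< (x k) (x i) k i) (inj₁ (Fin.combine-monoˡ-< _ _ lt)))
    where
    irrefl : ∀ ρ (j : Fin n) → ¬ Before ρ j j
    irrefl 0ℙ j = ℕ.<-irrefl refl
    irrefl 1ℙ j = ℕ.<-irrefl refl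
    ⇒ : key x k < key x i → (π ⟨$⟩ʳ k) Fin.< (π ⟨$⟩ʳ i)
    ⇒ lt with Fin.<-cmp (π ⟨$⟩ʳ k) (π ⟨$⟩ʳ i)
    ... | tri< l _ _ = l
    ... | tri≈ _ e _ with π-injective e
    ... | refl = contradiction lt (ℕ.<-irrefl refl)
    ⇒ lt | tri> _ _ g = contradiction lt
      (ℕ.<-asym (Equivalence.from (⊛-< (x i) (x k) i k) (inj₁ (Fin.combine-monoˡ-< _ _ g))))
  origins : ∀ i → originPermutation x ⟨$⟩ʳ i ≡ π ⟨$⟩ʳ i
  origins i = Fin.toℕ-injective (begin
    toℕ (originPermutation x ⟨$⟩ʳ i)              ≡⟨ toℕ-originPermutation x i ⟩
    rank (key x) i                                ≡⟨ #-cong (λ k → key x k ℕ.<? key x i)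
                                                       (λ k → (π ⟨$⟩ʳ k) Fin.<? (π ⟨$⟩ʳ i)) (λ k → ordered k i) ⟩
    # (λ k → (π ⟨$⟩ʳ k) Fin.<? (π ⟨$⟩ʳ i))        ≡⟨ sum-permute (λ (k : Fin n) → indicator (k Fin.<? (π ⟨$⟩ʳ i))) π ⟨
    # (λ (k : Fin n) → k Fin.<? (π ⟨$⟩ʳ i))                 ≡⟨ #-< (π ⟨$⟩ʳ i) ⟩
    toℕ (π ⟨$⟩ʳ i)                                ∎)
  bit-sign : ∀ s (p : Fin n) → s ≡ toSign (parity (toℕ (combine p (bit s))))
  bit-sign s p = begin
    s                                               ≡⟨ bits s ⟩
    toSign (parity (toℕ (bit s)))                   ≡⟨ cong (λ v → toSign (v ℙ.+ parity (toℕ (bit s)))) (ℙ.*-homo-* 2 (toℕ p)) ⟨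
    toSign (parity (2 * toℕ p) ℙ.+ parity (toℕ (bit s))) ≡⟨ cong toSign (ℙ.+-homo-+ (2 * toℕ p) _) ⟨
    toSign (parity (2 * toℕ p + toℕ (bit s)))       ≡⟨ cong (toSign ∘ parity) (Fin.toℕ-combine p (bit s)) ⟨
    toSign (parity (toℕ (combine p (bit s))))       ∎
    where
    bits : ∀ s → s ≡ toSign (parity (toℕ (bit s)))
    bits Sign.+ = refl
    bits Sign.- = refl
  eq : ∀ c → from w c ≡ from (orientedRuffle r) c
  eq (s , i) = trans (from-split w s i)
    (cong₂ _,_ (cong (s Sign.*_) (bit-sign (sign i) (π ⟨$⟩ʳ i))) (sym (origins i)))

everyRuffle : ∀ {n} (w : SignedPermutation n) → ∃ (IsRuffleWith w)
everyRuffle {zero}  w = 1 , εᵣ , refl , λ { (_ , ()) }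
everyRuffle {suc m} w = suc m * 2 , dealOneByOne w

orientedRising : ∀ {n} (w : SignedPermutation n) → ∃ (IsMinimum (IsRuffleWith w))
orientedRising w = minimum (isRuffleWith? w) (everyRuffle w)

orientedRisingNumber : ∀ n → DecMonoid.setoid (SignedPermutations n) ⟶ₛ ≡.setoid ℕ
orientedRisingNumber n = record
  { to   = proj₁ ∘ orientedRising
  ; cong = λ {v} {w} v≈w → ℕ.≤-antisym (le v w v≈w) (le w v (sym ∘ v≈w))
  }
  where
  le : ∀ (v w : SignedPermutation n) → v ≈ₛ w → proj₁ (orientedRising v) ≤ proj₁ (orientedRising w)
  le v w v≈w = proj₂ (proj₂ (orientedRising v)) _ (transport (proj₁ (proj₂ (orientedRising w))))
    where
    transport : ∀ {a} → IsRuffleWith w a → IsRuffleWith v a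
    transport (r , e , q) = r , e , λ c → trans (v≈w c) (q c)

{-# OPTIONS --safe #-}
module Submission where

-- Let ν w be the oriented rising number. Listing the cards of w in their original
-- order, the hands of an a-ruffle with outcome w form a weakly increasing sequence
-- with prescribed parities, in which two neighbours may only be equal if their final
-- positions are in the right order. There is a pointwise least such sequence, its last
-- term is ν w - 1, and every other one is obtained by adding a weakly increasing
-- sequence of even numbers. So the number of a-ruffles with outcome w depends only on
-- a and ν w; it is 0 if a < ν w and 1 if a = ν w. The sums of the outcomes of all
-- a-ruffles are therefore unitriangular combinations of the ν-class sums. As an
-- ab-ruffle is uniquely the product of an a-ruffle and a b-ruffle, these sums multiply
-- like the numbers a, whence closure and commutativity.

-- The parities are prescribed because exactly the odd hands are flipped, and two cards sharing a
-- hand must end up in increasing order if the hand is even and in decreasing order if it is odd. So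
-- between neighbours the hand grows by at least 1 if their orientations differ, and by at least 0
-- or 2 if they agree; beyond the parities there is no other constraint, and `a` enters only as a
-- bound on the last term. Hence the difference to the least sequence, the excess, can be carried
-- from `w` to any `v` with the same rising number. Injections in both directions show that the
-- multiplicities agree without computing them.
--
-- Formal sums are lists compared through their coefficients, so the product has to be shown to
-- respect this comparison. Linear functionals do it: a coefficient of a product is a functional of
-- either factor.
--
-- The product of two class sums is never computed. Triangularity shows that the class sums and the
-- images of the hand sums have the same span, and closure and commutativity are proved for the
-- latter.

open import Defs
open import Algebra.Bundles using (CommutativeMonoid)
import Algebra.Definitions.RawMonoid as RawMonoidDefinitions
open import Algebra.Morphism.Structures using (IsMonoidHomomorphism)
import Algebra.Properties.CommutativeMonoid.Sum as Sum
import Algebra.Properties.CommutativeSemigroup as CommutativeSemigroupProperties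
open import Data.Bool.Base using (true; false; if_then_else_)
open import Data.Fin.Base as Fin using (Fin; toℕ; fromℕ<; combine; finToFun; funToFin; quotient; remainder)
import Data.Fin.Properties as Fin
open import Data.Fin.Permutation as Perm using (Permutation′; _⟨$⟩ʳ_; _⟨$⟩ˡ_)
open import Data.List.Base
  using (List; []; _∷_; _++_; map; filter; length; lookup; allFin; cartesianProductWith; deduplicate)
open import Data.List.Properties using (map-++; map-∘)
open import Data.List.Membership.Propositional.Properties using (∈-allFin; ∈-filter⁺; ∈-lookup)
import Data.List.Membership.Setoid.Properties as Membership
open import Data.List.Relation.Unary.All as All using (All; []; _∷_)
import Data.List.Relation.Unary.All.Properties as All
open import Data.List.Relation.Unary.AllPairs using (AllPairs; []; _∷_)
open import Data.List.Relation.Unary.Any as Any using (Any; here; there)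
import Data.List.Relation.Unary.Any.Properties as Any
import Data.List.Relation.Unary.Unique.DecSetoid.Properties as UniqueDec
import Data.List.Relation.Unary.Unique.Propositional as Unique≡
import Data.List.Relation.Unary.Unique.Propositional.Properties as Unique≡
import Data.List.Relation.Unary.Unique.Setoid.Properties as Unique
open import Data.Nat.Base as ℕ
  using (ℕ; zero; suc; _+_; _∸_; _*_; _^_; _≤_; _<_; _≥_; _>_; z≤n; s≤s; NonZero; parity)
open import Data.Nat.DivMod using (_mod_; m<n⇒m%n≡m)
import Data.Nat.Properties as ℕ
open import Data.Parity.Base as ℙ using (Parity; 0ℙ; 1ℙ; toSign; fromSign)
import Data.Parity.Properties as ℙ
open import Data.Product.Base using (∃; Σ-syntax; _×_; _,_; proj₁; proj₂; map₁; map₂)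
open import Data.Rational.Base as ℚ using (ℚ; 0ℚ; 1ℚ)
import Data.Rational.Properties as ℚ
open import Data.Rational.Solver using (module +-*-Solver)
open import Data.Sign.Base as Sign using (Sign)
import Data.Sign.Properties as Sign
open import Data.Sum.Base using (_⊎_; inj₁; inj₂; [_,_]′)
open import Data.Vec.Functional using (Vector)
open import Function.Base using (_∘_)
open import Function.Bundles using (_⟶ₛ_; mk⇔; Func; Equivalence)
open import Level using (Level; _⊔_)
open import Relation.Binary.Bundles using (Setoid; DecSetoid)
import Relation.Binary.Construct.On as On
open import Relation.Binary.Core using (_Preserves_⟶_)
open import Relation.Binary.Definitions as B using (Tri; tri<; tri≈; tri>)
open import Relation.Binary.PropositionalEquality as ≡
  using (_≡_; refl; sym; trans; cong; cong₂; subst; subst₂; module ≡-Reasoning)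
open import Relation.Nullary using (¬_; Dec; yes; no; does; contradiction)
open import Relation.Nullary.Decidable using (does-⇔; dec-true; dec-false)
open import Relation.Unary using (Pred; Decidable; _∈_; _⊆_)

open CommutativeSemigroupProperties (CommutativeMonoid.commutativeSemigroup ℚ.+-0-commutativeMonoid)
  using () renaming (interchange to +-interchange)
open RawMonoidDefinitions ℚ.+-0-rawMonoid using () renaming (_×_ to _copiesOf_)
open Sum ℕ.+-0-commutativeMonoid using (sum-permute)

open SignedPermutation using (to; from)
open Ruffling using (hands; handOf)

-- Linear algebra in monoid algebras

private
  variable
    ℓ₁ ℓ₂ : Level
    A : Set ℓ₁
    B : Set ℓ₂

infix 3 _when_
_when_ : {P : Set ℓ₁} → ℚ → Dec P → ℚ
x when P? = if does P? then x else 0ℚ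

module _ {P : Set ℓ₁} (P? : Dec P) where
  when-true : ∀ {x} → P → (x when P?) ≡ x
  when-true h rewrite dec-true P? h = refl

  when-false : ∀ {x} → ¬ P → (x when P?) ≡ 0ℚ
  when-false h rewrite dec-false P? h = refl

  when-0 : (0ℚ when P?) ≡ 0ℚ
  when-0 with does P?
  ... | true  = refl
  ... | false = refl

  when-*ʳ : ∀ x y → (x when P?) ℚ.* y ≡ (x ℚ.* y when P?)
  when-*ʳ x y with does P?
  ... | true  = refl
  ... | false = ℚ.*-zeroˡ y

  when-*ˡ : ∀ x y → x ℚ.* (y when P?) ≡ (x ℚ.* y when P?)
  when-*ˡ x y with does P?
  ... | true  = refl
  ... | false = ℚ.*-zeroʳ x

when-⇔ : {P : Set ℓ₁} {Q : Set ℓ₂} (P? : Dec P) (Q? : Dec Q) → (P → Q) → (Q → P) →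
         ∀ x → (x when P?) ≡ (x when Q?)
when-⇔ P? Q? f g x = cong (if_then x else 0ℚ) (does-⇔ (mk⇔ f g) P? Q?)

∑ : (A → ℚ) → List A → ℚ
∑ f []       = 0ℚ
∑ f (x ∷ xs) = f x ℚ.+ ∑ f xs

∑-cong : {f g : A → ℚ} → (∀ x → f x ≡ g x) → ∀ xs → ∑ f xs ≡ ∑ g xs
∑-cong h []       = refl
∑-cong h (x ∷ xs) = cong₂ ℚ._+_ (h x) (∑-cong h xs)

∑-zero : {f : A → ℚ} (xs : List A) → All (λ x → f x ≡ 0ℚ) xs → ∑ f xs ≡ 0ℚ
∑-zero []       []       = refl
∑-zero (x ∷ xs) (h ∷ hs) = trans (cong₂ ℚ._+_ h (∑-zero xs hs)) (ℚ.+-identityˡ 0ℚ)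

∑-+ : (f g : A → ℚ) (xs : List A) → ∑ (λ x → f x ℚ.+ g x) xs ≡ ∑ f xs ℚ.+ ∑ g xs
∑-+ f g []       = refl
∑-+ f g (x ∷ xs) = trans (cong (f x ℚ.+ g x ℚ.+_) (∑-+ f g xs)) (+-interchange (f x) (g x) (∑ f xs) (∑ g xs))

∑-++ : (f : A → ℚ) (xs ys : List A) → ∑ f (xs ++ ys) ≡ ∑ f xs ℚ.+ ∑ f ys
∑-++ f []       ys = sym (ℚ.+-identityˡ _)
∑-++ f (x ∷ xs) ys = trans (cong (f x ℚ.+_) (∑-++ f xs ys)) (sym (ℚ.+-assoc (f x) _ _))

∑-map : (f : B → ℚ) (g : A → B) (xs : List A) → ∑ f (map g xs) ≡ ∑ (f ∘ g) xs
∑-map f g []       = refl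
∑-map f g (x ∷ xs) = cong (f (g x) ℚ.+_) (∑-map f g xs)

∑-*ˡ : ∀ q (f : A → ℚ) (xs : List A) → ∑ (λ x → q ℚ.* f x) xs ≡ q ℚ.* ∑ f xs
∑-*ˡ q f []       = sym (ℚ.*-zeroʳ q)
∑-*ˡ q f (x ∷ xs) = trans (cong (q ℚ.* f x ℚ.+_) (∑-*ˡ q f xs)) (sym (ℚ.*-distribˡ-+ q (f x) _))

module _ {s ℓ} (S : DecSetoid s ℓ) where
  open DecSetoid S using (_≈_; _≟_; Carrier) renaming (sym to ≈-sym; trans to ≈-trans)

  ∑-absent : ∀ (g : Carrier → ℚ) z {D} → ¬ Any (z ≈_) D → ∑ (λ x → g x when x ≟ z) D ≡ 0ℚ
  ∑-absent g z {D} z∉D = ∑-zero D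
    (All.map (λ {x} z≉x → when-false (x ≟ z) (z≉x ∘ ≈-sym)) (All.¬Any⇒All¬ D z∉D))

  ∑-unique : ∀ (g : Carrier → ℚ) → g Preserves _≈_ ⟶ _≡_ →
             ∀ z {D} → AllPairs (λ x y → ¬ x ≈ y) D → Any (z ≈_) D →
             ∑ (λ x → g x when x ≟ z) D ≡ g z
  ∑-unique g g-cong z {x ∷ D} (x∉D ∷ _) (here z≈x) = begin
    (g x when x ≟ z) ℚ.+ ∑ (λ x → g x when x ≟ z) D ≡⟨ cong₂ ℚ._+_ (when-true (x ≟ z) (≈-sym z≈x))
      (∑-absent g z (All.All¬⇒¬Any (All.map (λ x≉y z≈y → x≉y (≈-trans (≈-sym z≈x) z≈y)) x∉D))) ⟩
    g x ℚ.+ 0ℚ                                      ≡⟨ ℚ.+-identityʳ (g x) ⟩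
    g x                                             ≡⟨ g-cong (≈-sym z≈x) ⟩
    g z                                             ∎
    where open ≡-Reasoning
  ∑-unique g g-cong z {x ∷ D} (x∉D ∷ D!) (there z∈D) = trans
    (cong₂ ℚ._+_ (when-false (x ≟ z) x≉z) (∑-unique g g-cong z D! z∈D)) (ℚ.+-identityˡ (g z))
    where
    x≉z : ¬ x ≈ z
    x≉z x≈z = All.All¬⇒¬Any x∉D (Any.map (≈-trans x≈z) z∈D)

module Properties {c ℓ} (M : DecMonoid c ℓ) where
  open DecMonoid M using (Carrier; _≈_; _∙_; _≟_; setoid; ∙-cong)
    renaming (refl to ≈-refl; sym to ≈-sym; trans to ≈-trans)
  open MonoidAlgebra M

  decSetoid : DecSetoid c ℓ
  decSetoid = record { isDecEquivalence = record
    { isEquivalence = Setoid.isEquivalence setoid ; _≟_ = _≟_ } }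

  -- The linear functional extending `φ`. With `φ` equal to `δ m` it is the coefficient at `m`, so
  -- identities between formal sums reduce to identities between functionals.
  ⟪_⟫ : (Carrier → ℚ) → ℚ[_] → ℚ
  ⟪ φ ⟫ = ∑ (λ (q , x) → q ℚ.* φ x)

  δ : Carrier → Carrier → ℚ
  δ m x = 1ℚ when x ≟ m

  δ-cong : ∀ m → δ m Preserves _≈_ ⟶ _≡_
  δ-cong m {x} {y} x≈y = when-⇔ (x ≟ m) (y ≟ m) (≈-trans (≈-sym x≈y)) (≈-trans x≈y) 1ℚ

  ⟪⟫-cong : ∀ {φ ψ} → (∀ x → φ x ≡ ψ x) → ∀ u → ⟪ φ ⟫ u ≡ ⟪ ψ ⟫ u
  ⟪⟫-cong h = ∑-cong λ (q , x) → cong (q ℚ.*_) (h x)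

  ⟪⟫-⊕ : ∀ φ u v → ⟪ φ ⟫ (u ⊕ v) ≡ ⟪ φ ⟫ u ℚ.+ ⟪ φ ⟫ v
  ⟪⟫-⊕ φ = ∑-++ _

  ⟪⟫-· : ∀ φ q u → ⟪ φ ⟫ (q · u) ≡ q ℚ.* ⟪ φ ⟫ u
  ⟪⟫-· φ q u = trans (∑-map _ (map₁ (q ℚ.*_)) u)
    (trans (∑-cong (λ (p , x) → ℚ.*-assoc q p (φ x)) u) (∑-*ˡ q _ u))

  ⟪⟫-⊗ : ∀ φ u v → ⟪ φ ⟫ (u ⊗ v) ≡ ⟪ (λ x → ⟪ (λ y → φ (x ∙ y)) ⟫ v) ⟫ u
  ⟪⟫-⊗ φ []            v = refl
  ⟪⟫-⊗ φ ((p , x) ∷ u) v = trans (∑-++ _ (map _ v) (u ⊗ v)) (cong₂ ℚ._+_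
    (trans (∑-map _ _ v) (trans (∑-cong (λ (q , y) → ℚ.*-assoc p q (φ (x ∙ y))) v) (∑-*ˡ p _ v)))
    (⟪⟫-⊗ φ u v))

  coefficient≡⟪δ⟫ : ∀ u m → coefficient u m ≡ ⟪ δ m ⟫ u
  coefficient≡⟪δ⟫ []            m = refl
  coefficient≡⟪δ⟫ ((q , x) ∷ u) m = cong₂ ℚ._+_
    (sym (trans (when-*ˡ (x ≟ m) q 1ℚ) (cong (_when (x ≟ m)) (ℚ.*-identityʳ q))))
    (coefficient≡⟪δ⟫ u m)

  coefficient-∑ : ∀ u m → coefficient u m ≡ ∑ (λ (q , x) → q when x ≟ m) u
  coefficient-∑ []      m = refl
  coefficient-∑ ((q , x) ∷ u) m = cong ((q when x ≟ m) ℚ.+_) (coefficient-∑ u m)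

  coefficient-⊕ : ∀ u v m → coefficient (u ⊕ v) m ≡ coefficient u m ℚ.+ coefficient v m
  coefficient-⊕ u v m = trans (coefficient≡⟪δ⟫ (u ⊕ v) m) (trans (⟪⟫-⊕ (δ m) u v)
    (sym (cong₂ ℚ._+_ (coefficient≡⟪δ⟫ u m) (coefficient≡⟪δ⟫ v m))))

  coefficient-· : ∀ q u m → coefficient (q · u) m ≡ q ℚ.* coefficient u m
  coefficient-· q u m = trans (coefficient≡⟪δ⟫ (q · u) m) (trans (⟪⟫-· (δ m) q u)
    (sym (cong (q ℚ.*_) (coefficient≡⟪δ⟫ u m))))

  coefficient-absent : ∀ u m → ¬ Any (λ (_ , x) → m ≈ x) u → coefficient u m ≡ 0ℚ
  coefficient-absent u m m∉u = trans (coefficient-∑ u m) (∑-zero u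
    (All.map (λ {(_ , x)} m≉x → when-false (x ≟ m) (m≉x ∘ ≈-sym)) (All.¬Any⇒All¬ u m∉u)))

  ⟪⟫-expand : ∀ φ → φ Preserves _≈_ ⟶ _≡_ → ∀ {D} → AllPairs (λ x y → ¬ x ≈ y) D →
              ∀ u → All (λ (_ , x) → Any (x ≈_) D) u →
              ⟪ φ ⟫ u ≡ ∑ (λ z → coefficient u z ℚ.* φ z) D
  ⟪⟫-expand φ φ-cong {D} D! []            []        = sym (∑-zero D (All.tabulate λ {z} _ → ℚ.*-zeroˡ (φ z)))
  ⟪⟫-expand φ φ-cong {D} D! ((q , x) ∷ u) (x∈D ∷ h) = sym (begin
    ∑ (λ z → ((q when x ≟ z) ℚ.+ coefficient u z) ℚ.* φ z) D
      ≡⟨ ∑-cong (λ z → trans (ℚ.*-distribʳ-+ (φ z) (q when x ≟ z) (coefficient u z))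
           (cong (ℚ._+ coefficient u z ℚ.* φ z) (trans (when-*ʳ (x ≟ z) q (φ z))
             (when-⇔ (x ≟ z) (z ≟ x) ≈-sym ≈-sym (q ℚ.* φ z))))) D ⟩
    ∑ (λ z → (q ℚ.* φ z when z ≟ x) ℚ.+ coefficient u z ℚ.* φ z) D
      ≡⟨ ∑-+ _ _ D ⟩
    ∑ (λ z → q ℚ.* φ z when z ≟ x) D ℚ.+ ∑ (λ z → coefficient u z ℚ.* φ z) D
      ≡⟨ cong₂ ℚ._+_ (∑-unique decSetoid (λ z → q ℚ.* φ z) (λ e → cong (q ℚ.*_) (φ-cong e)) x D! x∈D)
           (sym (⟪⟫-expand φ φ-cong D! u h)) ⟩
    q ℚ.* φ x ℚ.+ ⟪ φ ⟫ u ∎)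
    where open ≡-Reasoning

  -- _≋_ as a record, so that the formal sums it relates can be inferred.
  infix 4 _≐_
  record _≐_ (u v : ℚ[_]) : Set c where
    constructor ⌈_⌉
    field at : u ≋ v
  open _≐_ public

  -- A functional runs over the listed terms, whereas `_≐_` knows only coefficients. Expanding both
  -- sums over one common list of distinct elements expresses both values by coefficients.
  ⟪⟫-resp-≐ : ∀ φ → φ Preserves _≈_ ⟶ _≡_ → ∀ {u v} → u ≐ v → ⟪ φ ⟫ u ≡ ⟪ φ ⟫ v
  ⟪⟫-resp-≐ φ φ-cong {u} {v} ⌈ u≋v ⌉ = begin
    ⟪ φ ⟫ u                             ≡⟨ ⟪⟫-expand φ φ-cong D! u (All.++⁻ˡ u covered) ⟩
    ∑ (λ z → coefficient u z ℚ.* φ z) D ≡⟨ ∑-cong (λ z → cong (ℚ._* φ z) (u≋v z)) D ⟩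
    ∑ (λ z → coefficient v z ℚ.* φ z) D ≡⟨ ⟪⟫-expand φ φ-cong D! v (All.++⁻ʳ u covered) ⟨
    ⟪ φ ⟫ v                             ∎
    where
    open ≡-Reasoning
    -- Drawn from both sums together, so that it covers the terms of either one.
    D : List Carrier
    D = deduplicate _≟_ (map proj₂ (u ++ v))
    D! : AllPairs (λ x y → ¬ x ≈ y) D
    D! = UniqueDec.deduplicate-! decSetoid _
    covered : All (λ (_ , x) → Any (x ≈_) D) (u ++ v)
    covered = All.map⁻ (All.tabulate λ x∈ → Any.deduplicate⁺ _≟_ (λ y≈x z≈y → ≈-trans z≈y (≈-sym y≈x))
      (Any.map (λ { refl → ≈-refl }) x∈))

  ≐-sym : ∀ {u v} → u ≐ v → v ≐ u
  ≐-sym ⌈ h ⌉ = ⌈ (λ m → sym (h m)) ⌉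

  ≐-trans : ∀ {u v w} → u ≐ v → v ≐ w → u ≐ w
  ≐-trans ⌈ h ⌉ ⌈ k ⌉ = ⌈ (λ m → trans (h m) (k m)) ⌉

  ⟪⟫⇒≐ : ∀ {u v} → (∀ m → ⟪ δ m ⟫ u ≡ ⟪ δ m ⟫ v) → u ≐ v
  ⟪⟫⇒≐ {u} {v} h = ⌈ (λ m → trans (coefficient≡⟪δ⟫ u m) (trans (h m) (sym (coefficient≡⟪δ⟫ v m)))) ⌉

  ⊕-cong : ∀ {u u′ v v′} → u ≐ u′ → v ≐ v′ → u ⊕ v ≐ u′ ⊕ v′
  ⊕-cong {u} {u′} {v} {v′} ⌈ h ⌉ ⌈ k ⌉ = ⌈ (λ m → trans (coefficient-⊕ u v m)
    (trans (cong₂ ℚ._+_ (h m) (k m)) (sym (coefficient-⊕ u′ v′ m)))) ⌉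

  ·-cong : ∀ q {u v} → u ≐ v → q · u ≐ q · v
  ·-cong q {u} {v} ⌈ h ⌉ = ⌈ (λ m → trans (coefficient-· q u m)
    (trans (cong (q ℚ.*_) (h m)) (sym (coefficient-· q v m)))) ⌉

  -- By `⟪⟫-⊗` the coefficient of the product at `m` depends on `v` only through functionals
  -- `y ↦ δ m (x ∙ y)`, which respect `≈`.
  ⊗-congˡ : ∀ u {v v′} → v ≐ v′ → u ⊗ v ≐ u ⊗ v′
  ⊗-congˡ u {v} {v′} h = ⟪⟫⇒≐ λ m → trans (⟪⟫-⊗ (δ m) u v) (trans
    (⟪⟫-cong (λ x → ⟪⟫-resp-≐ _ (λ e → δ-cong m (∙-cong ≈-refl e)) h) u)
    (sym (⟪⟫-⊗ (δ m) u v′)))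

  ⊗-congʳ : ∀ {u u′} v → u ≐ u′ → u ⊗ v ≐ u′ ⊗ v
  ⊗-congʳ {u} {u′} v h = ⟪⟫⇒≐ λ m → trans (⟪⟫-⊗ (δ m) u v) (trans
    (⟪⟫-resp-≐ _ (λ e → ⟪⟫-cong (λ y → δ-cong m (∙-cong e ≈-refl)) v) h)
    (sym (⟪⟫-⊗ (δ m) u′ v)))

  ⊗-distribʳ : ∀ u u′ v → (u ⊕ u′) ⊗ v ≐ u ⊗ v ⊕ u′ ⊗ v
  ⊗-distribʳ u u′ v = ⟪⟫⇒≐ λ m → trans (⟪⟫-⊗ (δ m) (u ⊕ u′) v) (trans (⟪⟫-⊕ _ u u′)
    (sym (trans (⟪⟫-⊕ (δ m) (u ⊗ v) (u′ ⊗ v)) (cong₂ ℚ._+_ (⟪⟫-⊗ (δ m) u v) (⟪⟫-⊗ (δ m) u′ v)))))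

  ⊗-distribˡ : ∀ u v v′ → u ⊗ (v ⊕ v′) ≐ u ⊗ v ⊕ u ⊗ v′
  ⊗-distribˡ u v v′ = ⟪⟫⇒≐ λ m → trans (⟪⟫-⊗ (δ m) u (v ⊕ v′)) (trans
    (∑-cong (λ (q , x) → trans (cong (q ℚ.*_) (⟪⟫-⊕ _ v v′)) (ℚ.*-distribˡ-+ q _ _)) u) (trans (∑-+ _ _ u)
    (sym (trans (⟪⟫-⊕ (δ m) (u ⊗ v) (u ⊗ v′)) (cong₂ ℚ._+_ (⟪⟫-⊗ (δ m) u v) (⟪⟫-⊗ (δ m) u v′))))))

  ·-⊗ˡ : ∀ q u v → (q · u) ⊗ v ≐ q · (u ⊗ v)
  ·-⊗ˡ q u v = ⟪⟫⇒≐ λ m → trans (⟪⟫-⊗ (δ m) (q · u) v) (trans (⟪⟫-· _ q u)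
    (sym (trans (⟪⟫-· (δ m) q (u ⊗ v)) (cong (q ℚ.*_) (⟪⟫-⊗ (δ m) u v)))))

  ·-⊗ʳ : ∀ q u v → u ⊗ (q · v) ≐ q · (u ⊗ v)
  ·-⊗ʳ q u v = ⟪⟫⇒≐ λ m → trans (⟪⟫-⊗ (δ m) u (q · v)) (trans
    (∑-cong (λ (p , x) → trans (cong (p ℚ.*_) (⟪⟫-· _ q v)) (swap p q _)) u) (trans (∑-*ˡ q _ u)
    (sym (trans (⟪⟫-· (δ m) q (u ⊗ v)) (cong (q ℚ.*_) (⟪⟫-⊗ (δ m) u v))))))
    where
    swap : ∀ p q r → p ℚ.* (q ℚ.* r) ≡ q ℚ.* (p ℚ.* r)
    swap p q r = trans (sym (ℚ.*-assoc p q r)) (trans (cong (ℚ._* r) (ℚ.*-comm p q)) (ℚ.*-assoc q p r))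

  ⊗-zeroʳ : ∀ u → u ⊗ 𝟘 ≐ 𝟘
  ⊗-zeroʳ u = ⟪⟫⇒≐ λ m → trans (⟪⟫-⊗ (δ m) u 𝟘) (∑-zero u (All.tabulate λ {(q , _)} _ → ℚ.*-zeroʳ q))

  -- Subspaces, spans and subalgebras

  record IsSubspace {p} (P : Pred ℚ[_] p) : Set (c ⊔ p) where
    field
      respects : ∀ {u v} → u ≐ v → u ∈ P → v ∈ P
      𝟘-closed : 𝟘 ∈ P
      ⊕-closed : ∀ {u v} → u ∈ P → v ∈ P → u ⊕ v ∈ P
      ·-closed : ∀ q {u} → u ∈ P → q · u ∈ P

  module _ {i p} {I : Set i} {b : I → ℚ[_]} {P : Pred ℚ[_] p} (P-subspace : IsSubspace P) where
    open IsSubspace P-subspace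

    linearCombination-closed : ∀ ts → All (λ (_ , j) → b j ∈ P) ts → linearCombination b ts ∈ P
    linearCombination-closed []       []       = 𝟘-closed
    linearCombination-closed (t ∷ ts) (h ∷ hs) = ⊕-closed (·-closed (proj₁ t) h) (linearCombination-closed ts hs)

    Span-minimal : (∀ j → b j ∈ P) → Span b ⊆ P
    Span-minimal b∈P {u} (ts , u≋) = respects (≐-sym {u} ⌈ u≋ ⌉)
      (linearCombination-closed ts (All.tabulate λ _ → b∈P _))

  module _ {i} {I : Set i} (b : I → ℚ[_]) where

    coefficient-linearCombination : ∀ ts m →
      coefficient (linearCombination b ts) m ≡ ∑ (λ (q , j) → q ℚ.* coefficient (b j) m) ts
    coefficient-linearCombination []             m = refl
    coefficient-linearCombination ((q , j) ∷ ts) m =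
      trans (coefficient-⊕ (q · b j) (linearCombination b ts) m)
        (cong₂ ℚ._+_ (coefficient-· q (b j) m) (coefficient-linearCombination ts m))

    generator∈Span : ∀ j → b j ∈ Span b
    generator∈Span j = (1ℚ , j) ∷ [] , λ m → sym (trans
      (coefficient-linearCombination ((1ℚ , j) ∷ []) m)
      (trans (ℚ.+-identityʳ _) (ℚ.*-identityˡ _)))

    Span-isSubspace : IsSubspace (Span b)
    Span-isSubspace = record
      { respects = λ u≐v (ts , h) → ts , at (≐-trans {v = _} {linearCombination b ts} (≐-sym u≐v) ⌈ h ⌉)
      ; 𝟘-closed = [] , λ _ → refl
      ; ⊕-closed = λ {u} {v} (ts , h) (ts′ , h′) → ts ++ ts′ , λ m → begin
          coefficient (u ⊕ v) m ≡⟨ coefficient-⊕ u v m ⟩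
          coefficient u m ℚ.+ coefficient v m ≡⟨ cong₂ ℚ._+_ (trans (h m) (coefficient-linearCombination ts m))
                                                            (trans (h′ m) (coefficient-linearCombination ts′ m)) ⟩
          ∑ _ ts ℚ.+ ∑ _ ts′ ≡⟨ ∑-++ _ ts ts′ ⟨
          ∑ _ (ts ++ ts′) ≡⟨ coefficient-linearCombination (ts ++ ts′) m ⟨
          coefficient (linearCombination b (ts ++ ts′)) m ∎
      ; ·-closed = λ q {u} (ts , h) → map (map₁ (q ℚ.*_)) ts , λ m → begin
          coefficient (q · u) m ≡⟨ coefficient-· q u m ⟩
          q ℚ.* coefficient u m ≡⟨ cong (q ℚ.*_) (trans (h m) (coefficient-linearCombination ts m)) ⟩
          q ℚ.* ∑ _ ts ≡⟨ ∑-*ˡ q _ ts ⟨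
          ∑ _ ts ≡⟨ ∑-cong (λ (p , j) → ℚ.*-assoc q p (coefficient (b j) m)) ts ⟨
          ∑ _ ts ≡⟨ ∑-map _ (map₁ (q ℚ.*_)) ts ⟨
          ∑ _ (map (map₁ (q ℚ.*_)) ts) ≡⟨ coefficient-linearCombination (map (map₁ (q ℚ.*_)) ts) m ⟨
          coefficient (linearCombination b (map (map₁ (q ℚ.*_)) ts)) m ∎
      }
      where open ≡-Reasoning

  -- Bilinearity in the form that `Span-minimal` consumes: membership of a product then needs
  -- checking on generators only, one factor at a time.
  ⊗-subspaceˡ : ∀ {p} {P : Pred ℚ[_] p} → IsSubspace P → ∀ v → IsSubspace (λ u → u ⊗ v ∈ P)
  ⊗-subspaceˡ P-subspace v = record
    { respects = λ h → respects (⊗-congʳ v h)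
    ; 𝟘-closed = 𝟘-closed
    ; ⊕-closed = λ {u} {u′} h h′ → respects (≐-sym (⊗-distribʳ u u′ v)) (⊕-closed h h′)
    ; ·-closed = λ q {u} h → respects (≐-sym (·-⊗ˡ q u v)) (·-closed q h)
    }
    where open IsSubspace P-subspace

  ⊗-subspaceʳ : ∀ {p} {P : Pred ℚ[_] p} → IsSubspace P → ∀ u → IsSubspace (λ v → u ⊗ v ∈ P)
  ⊗-subspaceʳ P-subspace u = record
    { respects = λ h → respects (⊗-congˡ u h)
    ; 𝟘-closed = respects (≐-sym (⊗-zeroʳ u)) 𝟘-closed
    ; ⊕-closed = λ {v} {v′} h h′ → respects (≐-sym (⊗-distribˡ u v v′)) (⊕-closed h h′)
    ; ·-closed = λ q {v} h → respects (≐-sym (·-⊗ʳ q u v)) (·-closed q h)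
    }
    where open IsSubspace P-subspace

  centralizer-isSubspace : ∀ v → IsSubspace (λ u → u ⊗ v ≐ v ⊗ u)
  centralizer-isSubspace v = record
    { respects = λ u≐u′ h → ≐-trans (⊗-congʳ v (≐-sym u≐u′)) (≐-trans h (⊗-congˡ v u≐u′))
    ; 𝟘-closed = ≐-sym (⊗-zeroʳ v)
    ; ⊕-closed = λ {u} {u′} h h′ → ≐-trans (⊗-distribʳ u u′ v)
        (≐-trans (⊕-cong {u ⊗ v} {v ⊗ u} h h′) (≐-sym (⊗-distribˡ v u u′)))
    ; ·-closed = λ q {u} h → ≐-trans (·-⊗ˡ q u v) (≐-trans (·-cong q {u ⊗ v} h) (≐-sym (·-⊗ʳ q v u)))
    }

  module _ {i} {I : Set i} (b : I → ℚ[_]) where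

    Span-isSubalgebra : (∀ j k → b j ⊗ b k ∈ Span b) → IsSubalgebra (Span b)
    Span-isSubalgebra closed = record
      { respects = λ {u} {v} u≋v → respects {u} {v} ⌈ u≋v ⌉
      ; 𝟘-closed = 𝟘-closed
      ; ⊕-closed = λ {u} {v} → ⊕-closed {u} {v}
      ; ·-closed = λ q {u} → ·-closed q {u}
      ; ⊗-closed = λ {u} u∈ v∈ → Span-minimal (⊗-subspaceʳ (Span-isSubspace b) u)
          (λ k → Span-minimal (⊗-subspaceˡ (Span-isSubspace b) (b k)) (λ j → closed j k) {u} u∈) v∈
      }
      where open IsSubspace (Span-isSubspace b)

    -- Two passes through centralizers: each generator commutes with the generators, hence with the
    -- whole span, and then every element of the span commutes with the span.
    Span-commutative : (∀ j k → b j ⊗ b k ≐ b k ⊗ b j) → Commutative (Span b)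
    Span-commutative comm {u} {v} u∈ v∈ = at (Span-minimal (centralizer-isSubspace v)
      (λ j → ≐-sym (Span-minimal (centralizer-isSubspace (b j)) (λ k → comm k j) v∈)) u∈)

  -- Sums of distinct elements and class sums

  monomials : List Carrier → ℚ[_]
  monomials = map (1ℚ ,_)

  monomials-⊗ : ∀ xs ys → monomials xs ⊗ monomials ys ≡ monomials (cartesianProductWith _∙_ xs ys)
  monomials-⊗ []       ys = refl
  monomials-⊗ (x ∷ xs) ys = trans (cong₂ _++_ (row x ys) (monomials-⊗ xs ys))
    (sym (map-++ (1ℚ ,_) (map (x ∙_) ys) _))
    where
    row : ∀ x ys → map (λ (q , y) → 1ℚ ℚ.* q , x ∙ y) (monomials ys) ≡ monomials (map (x ∙_) ys)
    row x []       = refl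
    row x (y ∷ ys) = cong ((1ℚ , x ∙ y) ∷_) (row x ys)

  coefficient-monomials : ∀ xs m → coefficient (monomials xs) m ≡ ∑ (λ x → 1ℚ when x ≟ m) xs
  coefficient-monomials xs m = trans (coefficient-∑ (monomials xs) m) (∑-map (λ (q , x) → q when x ≟ m) (1ℚ ,_) xs)

  coefficient-monomials-∈ : ∀ {xs} → AllPairs (λ x y → ¬ x ≈ y) xs →
                            ∀ m → Any (m ≈_) xs → coefficient (monomials xs) m ≡ 1ℚ
  coefficient-monomials-∈ {xs} xs! m m∈xs = trans (coefficient-monomials xs m)
    (∑-unique decSetoid (λ _ → 1ℚ) (λ _ → refl) m xs! m∈xs)

  coefficient-monomials-∉ : ∀ {xs} m → ¬ Any (m ≈_) xs → coefficient (monomials xs) m ≡ 0ℚ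
  coefficient-monomials-∉ {xs} m m∉xs = trans (coefficient-monomials xs m)
    (∑-absent decSetoid (λ _ → 1ℚ) m m∉xs)

  monomials-cong : ∀ {xs ys} → AllPairs (λ x y → ¬ x ≈ y) xs → AllPairs (λ x y → ¬ x ≈ y) ys →
                   (∀ m → Any (m ≈_) xs → Any (m ≈_) ys) → (∀ m → Any (m ≈_) ys → Any (m ≈_) xs) →
                   monomials xs ≐ monomials ys
  monomials-cong {xs} {ys} xs! ys! xs⊆ys ys⊆xs = ⌈ go ⌉
    where
    go : monomials xs ≋ monomials ys
    go m with Any.any? (m ≟_) xs
    ... | yes m∈xs = trans (coefficient-monomials-∈ xs! m m∈xs) (sym (coefficient-monomials-∈ ys! m (xs⊆ys m m∈xs)))
    ... | no  m∉xs = trans (coefficient-monomials-∉ m m∉xs) (sym (coefficient-monomials-∉ m (m∉xs ∘ ys⊆xs m)))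

  finite⇒finiteClasses : ∀ {v ℓᵥ} (V : DecSetoid v ℓᵥ) (μ : setoid ⟶ₛ DecSetoid.setoid V) →
                         ∀ xs → (∀ x → Any (x ≈_) xs) → HasFiniteClasses μ
  finite⇒finiteClasses V μ xs complete x = filter (_∼? x) (deduplicate _≟_ xs)
    , Unique.filter⁺ setoid (_∼? x) (UniqueDec.deduplicate-! decSetoid xs)
    , λ y → mk⇔ (λ y∈ → proj₂ (Membership.∈-filter⁻ setoid (_∼? x) resp {xs = deduplicate _≟_ xs} y∈))
        (Membership.∈-filter⁺ setoid (_∼? x) resp
          (Membership.∈-deduplicate⁺ setoid _≟_ (λ y≈z z≈x → ≈-trans z≈x (≈-sym y≈z)) (complete y)))
    where
    open DecSetoid V using () renaming (_≈_ to _≈ᵥ_; _≟_ to _≟ᵥ_; sym to ≈ᵥ-sym; trans to ≈ᵥ-trans)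
    _∼?_ : B.Decidable (λ y z → Func.to μ y ≈ᵥ Func.to μ z)
    y ∼? z = Func.to μ y ≟ᵥ Func.to μ z
    resp : ∀ {y z} → y ≈ z → Func.to μ y ≈ᵥ Func.to μ x → Func.to μ z ≈ᵥ Func.to μ x
    resp y≈z = ≈ᵥ-trans (≈ᵥ-sym (Func.cong μ y≈z))

  module Classes {v ℓᵥ} (V : DecSetoid v ℓᵥ) (μ : setoid ⟶ₛ DecSetoid.setoid V)
                 (finite : HasFiniteClasses μ) where

    classDecSetoid : DecSetoid c ℓᵥ
    classDecSetoid = On.decSetoid V (Func.to μ)

    open DecSetoid classDecSetoid using () renaming
      (_≈_ to _∼_; _≟_ to _∼?_; refl to ∼-refl; sym to ∼-sym; trans to ∼-trans)

    coefficient-classSum : ∀ x m → coefficient (classSum μ finite x) m ≡ (1ℚ when x ∼? m)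
    coefficient-classSum x m with x ∼? m in eq
    ... | yes x∼m = coefficient-monomials-∈ (proj₁ (proj₂ (finite x))) m
                      (Equivalence.from (proj₂ (proj₂ (finite x)) m) (∼-sym {x} {m} x∼m))
    ... | no  x≁m = coefficient-monomials-∉ m
                      (λ m∈ → x≁m (∼-sym {m} {x} (Equivalence.to (proj₂ (proj₂ (finite x)) m) m∈)))

    classSum-cong : ∀ {x y} → x ∼ y → classSum μ finite x ≐ classSum μ finite y
    classSum-cong {x} {y} x∼y = ⌈ (λ m → trans (coefficient-classSum x m) (trans
      (when-⇔ (x ∼? m) (y ∼? m) (∼-trans {y} {x} {m} (∼-sym {x} {y} x∼y)) (∼-trans {x} {y} {m} x∼y) 1ℚ)
      (sym (coefficient-classSum y m)))) ⌉

    coefficient-classSums : ∀ ts m →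
      coefficient (linearCombination (classSum μ finite) ts) m ≡ ∑ (λ (q , x) → q when x ∼? m) ts
    coefficient-classSums ts m = trans (coefficient-linearCombination (classSum μ finite) ts m)
      (∑-cong (λ (q , x) → trans (cong (q ℚ.*_) (coefficient-classSum x m))
        (trans (when-*ˡ (x ∼? m) q 1ℚ) (cong (_when (x ∼? m)) (ℚ.*-identityʳ q)))) ts)

    -- Classes are disjoint, so evaluating at the representative of the first class isolates its
    -- coefficient; the vanishing head is then dropped.
    classSums-independent : ∀ ts → AllPairs (λ (_ , x) (_ , y) → ¬ x ∼ y) ts →
      linearCombination (classSum μ finite) ts ≋ 𝟘 → All (λ (q , _) → q ≡ 0ℚ) ts
    classSums-independent ts ts! h = go ts ts! (λ m → trans (sym (coefficient-classSums ts m)) (h m))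
      where
      go : ∀ ts → AllPairs (λ (_ , x) (_ , y) → ¬ x ∼ y) ts →
           (∀ m → ∑ (λ (q , x) → q when x ∼? m) ts ≡ 0ℚ) → All (λ (q , _) → q ≡ 0ℚ) ts
      go []             []           h = []
      go ((q , x) ∷ ts) (x∉ts ∷ ts!) h = q≡0 ∷ go ts ts! λ m → begin
        ∑ _ ts                        ≡⟨ ℚ.+-identityˡ _ ⟨
        0ℚ ℚ.+ ∑ _ ts                 ≡⟨ cong (ℚ._+ _) (trans (cong (_when (x ∼? m)) q≡0) (when-0 (x ∼? m))) ⟨
        (q when x ∼? m) ℚ.+ ∑ _ ts    ≡⟨ h m ⟩
        0ℚ                            ∎
        where
        open ≡-Reasoning
        q≡0 : q ≡ 0ℚ
        q≡0 = begin
          q                          ≡⟨ ℚ.+-identityʳ q ⟨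
          q ℚ.+ 0ℚ                   ≡⟨ cong₂ ℚ._+_ (when-true (x ∼? x) (∼-refl {x}))
            (∑-zero ts (All.map (λ {(_ , y)} x≁y → when-false (y ∼? x) (x≁y ∘ ∼-sym {y} {x})) x∉ts)) ⟨
          (q when x ∼? x) ℚ.+ ∑ _ ts ≡⟨ h x ⟩
          0ℚ                         ∎

    classSums-isBasis : IsBasis (DecSetoid.setoid classDecSetoid) (classSum μ finite) (Span (classSum μ finite))
    classSums-isBasis = record
      { b-cong      = λ {x} {y} x∼y → at (classSum-cong {x} {y} x∼y)
      ; belongs     = generator∈Span (classSum μ finite)
      ; spans       = λ u∈ → u∈
      ; independent = classSums-independent
      }

    Span-isLumping : (∀ x y → classSum μ finite x ⊗ classSum μ finite y ∈ Span (classSum μ finite)) → IsLumping μ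
    Span-isLumping closed = record
      { finite       = finite
      ; Subalgebra   = Span (classSum μ finite)
      ; isSubalgebra = Span-isSubalgebra (classSum μ finite) closed
      ; isBasis      = classSums-isBasis
      }

    -- A class-constant sum is the combination of class sums weighted by its own coefficients. The
    -- alternative in the last hypothesis exempts the classes on which `u` vanishes; the induction
    -- on the rising number depends on this.
    constant⇒member : ∀ {p} {P : Pred ℚ[_] p} → IsSubspace P → ∀ u →
      (∀ {x y} → x ∼ y → coefficient u x ≡ coefficient u y) →
      (∀ x → coefficient u x ≡ 0ℚ ⊎ classSum μ finite x ∈ P) → u ∈ P
    constant⇒member {P = P} P-subspace u u-constant h = respects (≐-sym {u} ⌈ u≋ ⌉)
      (sum-closed D)
      where
      open IsSubspace P-subspace
      open ≡-Reasoning
      -- One representative for each class met by a listed term of `u`.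
      D : List Carrier
      D = deduplicate _∼?_ (map proj₂ u)
      term : Carrier → ℚ × Carrier
      term x = coefficient u x , x
      sum-closed : ∀ D → linearCombination (classSum μ finite) (map term D) ∈ P
      sum-closed []      = 𝟘-closed
      sum-closed (x ∷ D) = ⊕-closed (scaled (h x)) (sum-closed D)
        where
        scaled : _ ⊎ _ → coefficient u x · classSum μ finite x ∈ P
        scaled (inj₂ x∈P) = ·-closed (coefficient u x) x∈P
        scaled (inj₁ ux≡0) = respects {𝟘} ⌈ (λ m → sym (begin
          coefficient (coefficient u x · classSum μ finite x) m
            ≡⟨ coefficient-· (coefficient u x) (classSum μ finite x) m ⟩
          coefficient u x ℚ.* coefficient (classSum μ finite x) m
            ≡⟨ cong (ℚ._* coefficient (classSum μ finite x) m) ux≡0 ⟩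
          0ℚ ℚ.* coefficient (classSum μ finite x) m
            ≡⟨ ℚ.*-zeroˡ (coefficient (classSum μ finite x) m) ⟩
          0ℚ ∎)) ⌉ 𝟘-closed
      u≋ : u ≋ linearCombination (classSum μ finite) (map term D)
      u≋ m = sym (begin
        coefficient (linearCombination (classSum μ finite) (map term D)) m ≡⟨ coefficient-classSums (map term D) m ⟩
        ∑ (λ (q , x) → q when x ∼? m) (map term D)                        ≡⟨ ∑-map _ term D ⟩
        ∑ (λ x → coefficient u x when x ∼? m) D                           ≡⟨ value (Any.any? (m ∼?_) D) ⟩
        coefficient u m                                                   ∎)
        where
        value : Dec (Any (m ∼_) D) → ∑ (λ x → coefficient u x when x ∼? m) D ≡ coefficient u m
        value (yes m∈D) = ∑-unique classDecSetoid (coefficient u) u-constant m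
          (UniqueDec.deduplicate-! classDecSetoid _) m∈D
        value (no  m∉D) = trans (∑-absent classDecSetoid (coefficient u) m m∉D)
          (sym (coefficient-absent u m λ m∈u → m∉D (Any.deduplicate⁺ _∼?_
            (λ {x} {y} y∼x m∼y → ∼-trans {m} {x} {y} m∼y (∼-sym {y} {x} y∼x))
            (Any.map⁺ (Any.map (Func.cong μ) m∈u)))))

module _ {c₁ ℓ₁ c₂ ℓ₂} (M : DecMonoid c₁ ℓ₁) (N : DecMonoid c₂ ℓ₂) where
  private
    module M where
      open DecMonoid M public
      open MonoidAlgebra M public
      open Properties M public
    module N where
      open DecMonoid N public
      open MonoidAlgebra N public
      open Properties N public

  module _ (f : M.Carrier → N.Carrier) (f-cong : f Preserves M._≈_ ⟶ N._≈_) where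

    ⟪⟫-image : ∀ φ u → N.⟪ φ ⟫ (image M N f u) ≡ M.⟪ φ ∘ f ⟫ u
    ⟪⟫-image φ u = ∑-map _ (map₂ f) u

    image-cong : ∀ {u v} → u M.≐ v → image M N f u N.≐ image M N f v
    image-cong {u} {v} h = N.⟪⟫⇒≐ λ m → trans (⟪⟫-image (N.δ m) u)
      (trans (M.⟪⟫-resp-≐ _ (N.δ-cong m ∘ f-cong) h) (sym (⟪⟫-image (N.δ m) v)))

    image-⊗ : (∀ x y → f (x M.∙ y) N.≈ f x N.∙ f y) →
              ∀ u v → image M N f (u M.⊗ v) N.≐ image M N f u N.⊗ image M N f v
    image-⊗ homo u v = N.⟪⟫⇒≐ λ m → begin
      N.⟪ N.δ m ⟫ (image M N f (u M.⊗ v)) ≡⟨ ⟪⟫-image (N.δ m) (u M.⊗ v) ⟩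
      M.⟪ N.δ m ∘ f ⟫ (u M.⊗ v) ≡⟨ M.⟪⟫-⊗ (N.δ m ∘ f) u v ⟩
      M.⟪ (λ x → M.⟪ (λ y → N.δ m (f (x M.∙ y))) ⟫ v) ⟫ u
        ≡⟨ M.⟪⟫-cong (λ x → trans (M.⟪⟫-cong (λ y → N.δ-cong m (homo x y)) v)
                                  (sym (⟪⟫-image (λ y → N.δ m (f x N.∙ y)) v))) u ⟩
      M.⟪ (λ x → N.⟪ (λ y → N.δ m (f x N.∙ y)) ⟫ (image M N f v)) ⟫ u
        ≡⟨ ⟪⟫-image (λ x → N.⟪ (λ y → N.δ m (x N.∙ y)) ⟫ (image M N f v)) u ⟨
      N.⟪ (λ x → N.⟪ (λ y → N.δ m (x N.∙ y)) ⟫ (image M N f v)) ⟫ (image M N f u)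
        ≡⟨ N.⟪⟫-⊗ (N.δ m) (image M N f u) (image M N f v) ⟨
      N.⟪ N.δ m ⟫ (image M N f u N.⊗ image M N f v) ∎
      where open ≡-Reasoning

-- The algebra of ruffles

module _ {n : ℕ} where

  -- Checked on inverses, where a ruffle is given directly by the origins and signs of the cards.
  -- The signs multiply because `parity-⊛` adds the parities of the two hands.
  orientedRuffle-∙ : ∀ (r s : Ruffling n) → orientedRuffle (r ∙ᵣ s) ≈ₛ orientedRuffle r ∙ₛ orientedRuffle s
  orientedRuffle-∙ r@(ruffling a x) s@(ruffling b y) =
    ⁻¹ₛ-cong {v = orientedRuffle (r ∙ᵣ s) ⁻¹ₛ} {(orientedRuffle r ∙ₛ orientedRuffle s) ⁻¹ₛ}
      λ (t , i) → cong₂ _,_ (signs t i) (originᵣ-∙ r s i)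
    where
    open ≡-Reasoning
    signs : ∀ t i → t Sign.* toSign (parity (toℕ (handOf (r ∙ᵣ s) i)))
                  ≡ t Sign.* toSign (parity (toℕ (y i))) Sign.* toSign (parity (toℕ (x (originᵣ s i))))
    signs t i = begin
      t Sign.* toSign (parity (toℕ (x (originᵣ s i) ⊛ y i))) ≡⟨ cong (λ p → t Sign.* toSign p)
        (trans (parity-⊛ (x (originᵣ s i)) (y i)) (ℙ.+-comm (parity (toℕ (x (originᵣ s i)))) (parity (toℕ (y i))))) ⟩
      t Sign.* toSign (parity (toℕ (y i)) ℙ.+ parity (toℕ (x (originᵣ s i))))
        ≡⟨ cong (t Sign.*_) (ℙ.+-homo-* (parity (toℕ (y i))) _) ⟩
      t Sign.* (toSign (parity (toℕ (y i))) Sign.* toSign (parity (toℕ (x (originᵣ s i))))) ≡⟨ Sign.*-assoc t _ _ ⟨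
      _ ∎

  orientedRuffle-ε : orientedRuffle (εᵣ {n}) ≈ₛ idₛ
  orientedRuffle-ε = ⁻¹ₛ-cong {v = orientedRuffle εᵣ ⁻¹ₛ} {idₛ ⁻¹ₛ}
    λ (t , i) → cong₂ _,_ (Sign.*-identityʳ t) (originᵣ-ε i)

  orientedRuffle-isHomomorphism : IsMonoidHomomorphism
    (DecMonoid.rawMonoid (Ruffles n)) (DecMonoid.rawMonoid (SignedPermutations n)) orientedRuffle
  orientedRuffle-isHomomorphism = record
    { isMagmaHomomorphism = record
      { isRelHomomorphism = record { cong = λ {r} {s} → orientedRuffle-cong {r = r} {s} }
      ; homo = orientedRuffle-∙
      }
    ; ε-homo = orientedRuffle-ε
    }

  -- An opaque copy of orientedRuffle, whose unfolding makes conversion checking very slow.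
  opaque
    outcome : Ruffling n → SignedPermutation n
    outcome = orientedRuffle

    outcome≡ : outcome ≡ orientedRuffle
    outcome≡ = refl

  outcome-isHomomorphism : IsMonoidHomomorphism
    (DecMonoid.rawMonoid (Ruffles n)) (DecMonoid.rawMonoid (SignedPermutations n)) outcome
  outcome-isHomomorphism = subst (IsMonoidHomomorphism _ _) (sym outcome≡) orientedRuffle-isHomomorphism

  outcome-cong : ∀ {r s : Ruffling n} → r ≈ᵣ s → outcome r ≈ₛ outcome s
  outcome-cong {r} {s} = IsMonoidHomomorphism.⟦⟧-cong outcome-isHomomorphism {r} {s}

  private
    open module Ruffles′ = DecMonoid (Ruffles n) using (setoid)
    open MonoidAlgebra (Ruffles n)
    open Properties (Ruffles n)

  finToFun-injective : ∀ {a} {k l : Fin (a ^ n)} →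
                       (∀ i → finToFun {a} {n} k i ≡ finToFun {a} {n} l i) → k ≡ l
  finToFun-injective {a} {k} {l} eq = trans (sym (Fin.funToFin-finToFin {n} {a} k))
    (trans (funToFin-cong eq) (Fin.funToFin-finToFin {n} {a} l))
    where
    funToFin-cong : ∀ {m} {f g : Fin m → Fin a} → (∀ i → f i ≡ g i) → funToFin f ≡ funToFin g
    funToFin-cong {ℕ.zero}  h = refl
    funToFin-cong {ℕ.suc m} h = cong₂ combine (h Fin.zero) (funToFin-cong (h ∘ Fin.suc))

  module _ (a : ℕ) .{{_ : NonZero a}} where

    nth : Fin (a ^ n) → Ruffling n
    nth k = ruffling a (finToFun k)

    nth-injective : ∀ {k l} → nth k ≈ᵣ nth l → k ≡ l
    nth-injective (_ , eq) = finToFun-injective (λ i → Fin.toℕ-injective (eq i))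

    ruffles : List (Ruffling n)
    ruffles = map nth (allFin (a ^ n))

    ruffles-distinct : AllPairs (λ r s → ¬ r ≈ᵣ s) ruffles
    ruffles-distinct = Unique.map⁺ (≡.setoid _) setoid nth-injective (Unique≡.allFin⁺ _)

    nth-surjective : ∀ r → hands r ≡ a → ∃ λ k → r ≈ᵣ nth k
    nth-surjective (ruffling _ x) refl = funToFin x , refl , λ i → cong toℕ (sym (Fin.finToFun-funToFin x i))

    ∈-ruffles⁺ : ∀ r → hands r ≡ a → Any (r ≈ᵣ_) ruffles
    ∈-ruffles⁺ r hands≡ with k , r≈ ← nth-surjective r hands≡ =
      Any.map (λ { refl → r≈ }) (Membership.∈-map⁺ (≡.setoid _) (≡.setoid _) (cong nth) (∈-allFin k))

    ∈-ruffles⁻ : ∀ {r} → Any (r ≈ᵣ_) ruffles → hands r ≡ a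
    ∈-ruffles⁻ {r} r∈ with _ , _ , eq ← Membership.∈-map⁻ (≡.setoid _) setoid {r} r∈ = proj₁ eq

  handClasses : HasFiniteClasses (hand n)
  handClasses r@(ruffling a _) = ruffles a , ruffles-distinct a ,
    λ s → mk⇔ (∈-ruffles⁻ a {s}) (∈-ruffles⁺ a s)

  -- Unique factorisation of ruffles

  module _ (a b : ℕ) .{{_ : NonZero a}} .{{_ : NonZero b}} where
    private instance
      ab≢0 : NonZero (a * b)
      ab≢0 = ℕ.m*n≢0 a b

    private
      products : List (Ruffling n)
      products = cartesianProductWith (λ k l → nth a k ∙ᵣ nth b l) (allFin (a ^ n)) (allFin (b ^ n))

    -- The factor `y` is recovered first, position by position, from the remainders modulo `b`. Then
    -- the origins under the second ruffle are known, and undoing them recovers `x` from the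
    -- quotients.
    ∙ᵣ-injective : ∀ {x x′ : Vector (Fin a) n} {y y′ : Vector (Fin b) n} →
      ruffling a x ∙ᵣ ruffling b y ≈ᵣ ruffling a x′ ∙ᵣ ruffling b y′ →
      ruffling a x ≈ᵣ ruffling a x′ × ruffling b y ≈ᵣ ruffling b y′
    ∙ᵣ-injective {x} {x′} {y} {y′} (_ , eq) = (refl , x≡) , s≈s′
      where
      open ≡-Reasoning
      s s′ : Ruffling n
      s = ruffling b y
      s′ = ruffling b y′
      s≈s′ : s ≈ᵣ s′
      s≈s′ = refl , λ i → cong toℕ (⊛-injectiveʳ {j = x (originᵣ s i)} {x′ (originᵣ s′ i)} (eq i))
      j≡ : ∀ i → x (originᵣ s i) ≡ x′ (originᵣ s′ i)
      j≡ i = proj₁ (Fin.combine-injective (x (originᵣ s i)) _ (x′ (originᵣ s′ i)) _ (Fin.toℕ-injective (eq i)))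
      x≡ : ∀ k → toℕ (x k) ≡ toℕ (x′ k)
      x≡ k = cong toℕ (begin
        x k                    ≡⟨ cong x (Perm.inverseʳ π) ⟨
        x (originᵣ s i)        ≡⟨ j≡ i ⟩
        x′ (originᵣ s′ i)      ≡⟨ cong x′ (originᵣ-cong s s′ s≈s′ i) ⟨
        x′ (originᵣ s i)       ≡⟨ cong x′ (Perm.inverseʳ π) ⟩
        x′ k                   ∎)
        where
        π = originPermutation y
        i = π ⟨$⟩ˡ k

    -- Division of each entry by `b`, where an odd quotient means that the remainder is stored
    -- reversed.
    ∙ᵣ-surjective : ∀ (z : Vector (Fin (a * b)) n) →
      ∃ λ x → ∃ λ y → ruffling (a * b) z ≈ᵣ ruffling a x ∙ᵣ ruffling b y
    ∙ᵣ-surjective z = x , y , refl , λ i → cong toℕ (sym (begin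
      x (originᵣ s i) ⊛ y i                      ≡⟨ cong (λ k → j k ⊛ y i) (Perm.inverseˡ π) ⟩
      combine (j i) (orient (p i) (orient (p i) (remainder {a} b (z i))))
                                                 ≡⟨ cong (combine (j i)) (involutive (p i) _) ⟩
      combine (j i) (remainder {a} b (z i))          ≡⟨ Fin.combine-remQuot {a} b (z i) ⟩
      z i                                        ∎))
      where
      open ≡-Reasoning
      j : Vector (Fin a) n
      j i = quotient b (z i)
      p = λ i → parity (toℕ (j i))
      y : Vector (Fin b) n
      y i = orient (p i) (remainder {a} b (z i))
      s = ruffling b y
      π = originPermutation y
      x : Vector (Fin a) n
      -- The quotients are indexed by final positions, but `x` by positions before the second
      -- ruffle; `π` translates between them and depends only on `y`.
      x k = j (π ⟨$⟩ˡ k)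
      involutive : ∀ {m} q (i : Fin m) → orient q (orient q i) ≡ i
      involutive 0ℙ i = refl
      involutive 1ℙ i = Fin.opposite-involutive i

    private
      products-distinct : AllPairs (λ r s → ¬ r ≈ᵣ s) products
      products-distinct = Unique.cartesianProductWith⁺ (≡.setoid _) (≡.setoid _) setoid _
        (λ eq → let e₁ , e₂ = ∙ᵣ-injective eq in nth-injective a e₁ , nth-injective b e₂)
        (Unique≡.allFin⁺ _) (Unique≡.allFin⁺ _)

      products⊆ : ∀ r → Any (r ≈ᵣ_) products → Any (r ≈ᵣ_) (ruffles (a * b))
      products⊆ r r∈
        with Membership.∈-cartesianProductWith⁻ (≡.setoid _) (≡.setoid _) setoid _ (allFin _) (allFin _) {r} r∈
      ... | k , l , _ , _ , r≈ = Membership.∈-resp-≈ setoid {x = nth a k ∙ᵣ nth b l} {r}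
              (Setoid.sym setoid {r} {nth a k ∙ᵣ nth b l} r≈) (∈-ruffles⁺ (a * b) (nth a k ∙ᵣ nth b l) refl)

      ⊆products : ∀ r → Any (r ≈ᵣ_) (ruffles (a * b)) → Any (r ≈ᵣ_) products
      ⊆products r@(ruffling c z) r∈ with refl ← ∈-ruffles⁻ (a * b) {r} r∈ =
        let x , y , z≈ = ∙ᵣ-surjective z in
        Any.map (λ { {s} refl → Setoid.trans setoid {r} {ruffling a x ∙ᵣ ruffling b y} {s} z≈
          (∙ᵣ-cong {r = ruffling a x} {nth a (funToFin x)} {ruffling b y} {nth b (funToFin y)}
            (refl , λ i → cong toℕ (sym (Fin.finToFun-funToFin x i)))
            (refl , λ i → cong toℕ (sym (Fin.finToFun-funToFin y i)))) })
          (Membership.∈-cartesianProductWith⁺ (≡.setoid _) (≡.setoid _) (≡.setoid _)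
            (cong₂ (λ k l → nth a k ∙ᵣ nth b l))
            (∈-allFin (funToFin x)) (∈-allFin (funToFin y)))

    ruffles-⊗ : monomials (ruffles a) ⊗ monomials (ruffles b) ≐ monomials (ruffles (a * b))
    ruffles-⊗ = subst (_≐ monomials (ruffles (a * b)))
      (sym (trans (monomials-⊗ (ruffles a) (ruffles b))
        (cong monomials (cartesianProductWith-map (allFin (a ^ n)) (allFin (b ^ n))))))
      (monomials-cong products-distinct (ruffles-distinct (a * b)) products⊆ ⊆products)
      where
      cartesianProductWith-map : ∀ ks ls → cartesianProductWith _∙ᵣ_ (map (nth a) ks) (map (nth b) ls)
                                         ≡ cartesianProductWith (λ k l → nth a k ∙ᵣ nth b l) ks ls
      cartesianProductWith-map []       ls = refl
      cartesianProductWith-map (k ∷ ks) ls = cong₂ _++_ (sym (map-∘ ls)) (cartesianProductWith-map ks ls)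

  handSum : Ruffling n → ℚ[_]
  handSum = classSum (hand n) handClasses

  handSum-⊗ : ∀ r s → handSum r ⊗ handSum s ≐ handSum (r ∙ᵣ s)
  handSum-⊗ r@(ruffling a _) s@(ruffling b _) = ruffles-⊗ a b

  handSum-comm : ∀ r s → handSum (r ∙ᵣ s) ≐ handSum (s ∙ᵣ r)
  handSum-comm r@(ruffling a _) s@(ruffling b _) = classSum-cong {r ∙ᵣ s} {s ∙ᵣ r} (ℕ.*-comm a b)
    where open Classes ℕ.≡-decSetoid (hand n) handClasses

  hand-isLumping : IsLumping (hand n)
  hand-isLumping = Span-isLumping λ r s →
    IsSubspace.respects (Span-isSubspace handSum) (≐-sym (handSum-⊗ r s)) (generator∈Span handSum (r ∙ᵣ s))
    where open Classes ℕ.≡-decSetoid (hand n) handClasses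

-- Ruffles with a given outcome

-- The least difference between the hands of two consecutive cards, ending up in
-- positions k and i and coming from hands of parities ρ and σ.
gap : ∀ {n} → Parity → Parity → Fin n → Fin n → ℕ
gap ρ σ k i with ρ ℙ.≟ σ | before? σ k i
... | no  _ | _     = 1
... | yes _ | yes _ = 0
... | yes _ | no  _ = 2

parity-gap : ∀ {n} ρ σ (k i : Fin n) → parity (gap ρ σ k i) ≡ ρ ℙ.+ σ
parity-gap ρ σ k i with ρ ℙ.≟ σ | before? σ k i
parity-gap 0ℙ 0ℙ k i | no ρ≢σ | _ = contradiction refl ρ≢σ
parity-gap 0ℙ 1ℙ k i | no ρ≢σ | _ = refl
parity-gap 1ℙ 0ℙ k i | no ρ≢σ | _ = refl
parity-gap 1ℙ 1ℙ k i | no ρ≢σ | _ = contradiction refl ρ≢σ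
... | yes refl | yes _ = sym (ℙ.p+p≡0ℙ ρ)
... | yes refl | no  _ = sym (ℙ.p+p≡0ℙ ρ)

module _ {n} {h h′ : ℕ} (k i : Fin n) where

  -- Here the hypothesis is the criterion of `⊛-<` for increasing keys. If the parities agree,
  -- `h < h′` already forces a difference of 2, so demanding 2 where equal hands are forbidden loses
  -- nothing.
  gap-≤ : h < h′ ⊎ (h ≡ h′ × Before (parity h′) k i) → h + gap (parity h) (parity h′) k i ≤ h′
  gap-≤ lt with parity h ℙ.≟ parity h′ | before? (parity h′) k i
  gap-≤ (inj₁ h<h′)       | no _   | _       = subst (_≤ h′) (ℕ.+-comm 1 h) h<h′
  gap-≤ (inj₂ (refl , _)) | no ρ≢σ | _       = contradiction refl ρ≢σ
  gap-≤ (inj₁ h<h′)       | yes _  | yes _   = subst (_≤ h′) (ℕ.+-comm 0 h) (ℕ.<⇒≤ h<h′)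
  gap-≤ (inj₂ (refl , _)) | yes _  | yes _   = ℕ.≤-reflexive (ℕ.+-identityʳ h)
  gap-≤ (inj₂ (_ , b))    | yes _  | no ¬b   = contradiction b ¬b
  gap-≤ (inj₁ h<h′)       | yes e  | no _    = subst (_≤ h′) (ℕ.+-comm 2 h) (ℕ.≤∧≢⇒< h<h′
    λ { refl → ℙ.p≢p⁻¹ (parity (suc h)) (trans (sym e) (sym (ℙ.suc-homo-⁻¹ h))) })

  gap-≤⁻ : h + gap (parity h) (parity h′) k i ≤ h′ → h < h′ ⊎ (h ≡ h′ × Before (parity h′) k i)
  gap-≤⁻ le with parity h ℙ.≟ parity h′ | before? (parity h′) k i
  ... | no _   | _       = inj₁ (subst (_≤ h′) (ℕ.+-comm h 1) le)
  ... | yes _  | no _    = inj₁ (ℕ.<⇒≤ (subst (_≤ h′) (ℕ.+-comm h 2) le))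
  ... | yes _  | yes b   with ℕ.m≤n⇒m<n∨m≡n (subst (_≤ h′) (ℕ.+-identityʳ h) le)
  ...   | inj₁ h<h′ = inj₁ h<h′
  ...   | inj₂ h≡h′ = inj₂ (h≡h′ , b)

-- The possible hands for a given outcome

module _ {m : ℕ} (w : SignedPermutation (suc m)) where
  private
    n = suc m

    π : Permutation′ n
    π = forgetOrientation w

  -- Positions are 0-based; finalPosition p is junk unless p < n.
  finalPosition : ℕ → Fin n
  finalPosition p = π ⟨$⟩ʳ (p mod n)

  initialPosition : Fin n → ℕ
  initialPosition i = toℕ (π ⟨$⟩ˡ i)

  final-initial : ∀ i → finalPosition (initialPosition i) ≡ i
  final-initial i = trans (cong (π ⟨$⟩ʳ_) (Fin.toℕ-injective (trans (Fin.toℕ-fromℕ< _)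
    (m<n⇒m%n≡m (Fin.toℕ<n (π ⟨$⟩ˡ i)))))) (Perm.inverseʳ π)

  initial-final : ∀ {p} → p < n → initialPosition (finalPosition p) ≡ p
  initial-final p<n = trans (cong toℕ (Perm.inverseˡ π)) (trans (Fin.toℕ-fromℕ< _) (m<n⇒m%n≡m p<n))

  initial≤m : ∀ i → initialPosition i ≤ m
  initial≤m i = ℕ.≤-pred (Fin.toℕ<n (π ⟨$⟩ˡ i))

  -- The parity of the hand of this card in every ruffle with outcome `w`. The sign of the inverse
  -- at the final position is the sign of `w` at the initial one.
  turned : Fin n → Parity
  turned i = fromSign (proj₁ (from w (Sign.+ , i)))

  -- leastHand p is the least possible hand of the card in initial position p.
  leastHand : ℕ → ℕ
  leastHand zero    with turned (finalPosition 0)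
  ... | 0ℙ = 0
  ... | 1ℙ = 1
  leastHand (suc p) = leastHand p + gap (turned k) (turned i) k i
    where
    k = finalPosition p
    i = finalPosition (suc p)

  parity-leastHand : ∀ p → parity (leastHand p) ≡ turned (finalPosition p)
  parity-leastHand zero with turned (finalPosition 0)
  ... | 0ℙ = refl
  ... | 1ℙ = refl
  parity-leastHand (suc p) = begin
    parity (leastHand p + gap ρ σ k i) ≡⟨ ℙ.+-homo-+ (leastHand p) (gap ρ σ k i) ⟩
    parity (leastHand p) ℙ.+ parity (gap ρ σ k i) ≡⟨ cong₂ ℙ._+_ (parity-leastHand p) (parity-gap ρ σ k i) ⟩
    ρ ℙ.+ (ρ ℙ.+ σ) ≡⟨ ℙ.+-assoc ρ ρ σ ⟨
    ρ ℙ.+ ρ ℙ.+ σ ≡⟨ cong (ℙ._+ σ) (ℙ.p+p≡0ℙ ρ) ⟩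
    σ ∎
    where
    open ≡-Reasoning
    k = finalPosition p
    i = finalPosition (suc p)
    ρ = turned k
    σ = turned i

  module _ {a : ℕ} .{{_ : NonZero a}} (x : Vector (Fin a) n) where

    private
      hand′ : ℕ → ℕ
      hand′ p = toℕ (x (finalPosition p))

    -- Having outcome `w`, rewritten as conditions on single cards and on neighbours in the original
    -- order. In this form solutions can be shifted by a sequence.
    record Yields : Set where
      field
        parities : ∀ i → parity (toℕ (x i)) ≡ turned i
        gaps     : ∀ {p} → p < m → hand′ p + gap (turned (finalPosition p)) (turned (finalPosition (suc p)))
                                               (finalPosition p) (finalPosition (suc p)) ≤ hand′ (suc p)

    yields⁺ : outcome (ruffling a x) ≈ₛ w → Yields
    yields⁺ ≈w = record { parities = parities ; gaps = gaps }
      where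
      w⁻¹≈ : w ⁻¹ₛ ≈ₛ orientedRuffle (ruffling a x) ⁻¹ₛ
      w⁻¹≈ = ⁻¹ₛ-cong {v = w} {orientedRuffle (ruffling a x)}
        (sym ∘ subst (λ f → f (ruffling a x) ≈ₛ w) outcome≡ ≈w)
      parities : ∀ i → parity (toℕ (x i)) ≡ turned i
      parities i = sym (trans (cong (fromSign ∘ proj₁) (w⁻¹≈ (Sign.+ , i))) (ℙ.toSign-inverseʳ refl))
      -- The two cards have origins `p` and `suc p`, and origins are ordered like keys.
      key< : ∀ {p} → p < m → key x (finalPosition p) < key x (finalPosition (suc p))
      key< {p} p<m = Equivalence.to (originᵣ-< (ruffling a x)) (subst₂ _<_
        (origin≡ (ℕ.m<n⇒m<1+n p<m)) (origin≡ (s≤s p<m)) (ℕ.n<1+n p))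
        where
        origin≡ : ∀ {p} → p < n → p ≡ toℕ (originᵣ (ruffling a x) (finalPosition p))
        origin≡ p<n = trans (sym (initial-final p<n)) (cong (toℕ ∘ proj₂) (w⁻¹≈ (Sign.+ , _)))
      gaps : ∀ {p} → p < m → _ ≤ hand′ (suc p)
      gaps {p} p<m = subst₂ (λ ρ σ → hand′ p + gap ρ σ k i ≤ hand′ (suc p)) (parities k) (parities i)
        (gap-≤ k i ([ inj₁ , (λ (e , b) → inj₂ (cong toℕ e , b)) ]′
          (Equivalence.to (⊛-< (x k) (x i) k i) (key< p<m))))
        where
        k = finalPosition p
        i = finalPosition (suc p)

    -- The neighbour conditions chain up: keys increase strictly along the original order. So the
    -- rank of a key counts the cards originally above, and the origin given by the ruffle is the
    -- one prescribed by `w`.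
    yields⁻ : Yields → outcome (ruffling a x) ≈ₛ w
    yields⁻ y = subst (λ f → f (ruffling a x) ≈ₛ w) (sym outcome≡)
      (sym ∘ ⁻¹ₛ-cong {v = w ⁻¹ₛ} {orientedRuffle (ruffling a x) ⁻¹ₛ} λ (t , i) →
      trans (from-split w t i) (cong₂ _,_ (cong (t Sign.*_) (sign i)) (Fin.toℕ-injective (sym (origin≡ i)))))
      where
      open Yields y
      open ≡-Reasoning
      sign : ∀ i → proj₁ (from w (Sign.+ , i)) ≡ toSign (parity (toℕ (x i)))
      sign i = sym (trans (cong toSign (parities i)) (ℙ.toSign-inverseˡ refl))
      step : ∀ {p} → p < m → key x (finalPosition p) < key x (finalPosition (suc p))
      step {p} p<m = Equivalence.from (⊛-< (x k) (x i) k i)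
        ([ inj₁ , (λ (e , b) → inj₂ (Fin.toℕ-injective e , b)) ]′
          (gap-≤⁻ k i (subst₂ (λ ρ σ → hand′ p + gap ρ σ k i ≤ hand′ (suc p))
            (sym (parities k)) (sym (parities i)) (gaps p<m))))
        where
        k = finalPosition p
        i = finalPosition (suc p)
      increasing : ∀ {p q} → p < q → q ≤ m → key x (finalPosition p) < key x (finalPosition q)
      increasing {p} {suc q} (s≤s p≤q) q<m with ℕ.m≤n⇒m<n∨m≡n p≤q
      ... | inj₁ p<q  = ℕ.<-trans (increasing p<q (ℕ.<⇒≤ q<m)) (step q<m)
      ... | inj₂ refl = step q<m
      ordered : ∀ {k i} → initialPosition k < initialPosition i → key x k < key x i
      ordered {k} {i} lt = subst₂ (λ k i → key x k < key x i) (final-initial k) (final-initial i)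
        (increasing lt (initial≤m i))
      ordered⁻ : ∀ {k i} → key x k < key x i → initialPosition k < initialPosition i
      ordered⁻ {k} {i} lt with ℕ.<-cmp (initialPosition k) (initialPosition i)
      ... | tri< l _ _ = l
      ... | tri≈ _ e _ = contradiction lt (ℕ.<-irrefl (cong (key x)
                           (trans (sym (final-initial k)) (trans (cong finalPosition e) (final-initial i)))))
      ... | tri> _ _ g = contradiction lt (ℕ.<-asym (ordered g))
      origin≡ : ∀ i → toℕ (originᵣ (ruffling a x) i) ≡ initialPosition i
      origin≡ i = begin
        toℕ (originᵣ (ruffling a x) i) ≡⟨ toℕ-originᵣ (ruffling a x) i ⟩
        rank (key x) i ≡⟨ #-cong (λ k → key x k ℕ.<? key x i) (λ k → (π ⟨$⟩ˡ k) Fin.<? (π ⟨$⟩ˡ i))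
                            (λ k → mk⇔ ordered⁻ ordered) ⟩
        # (λ k → (π ⟨$⟩ˡ k) Fin.<? (π ⟨$⟩ˡ i))
          -- Reindexing turns a count of final positions into a count of initial positions.
          ≡⟨ sum-permute (λ k → indicator (k Fin.<? (π ⟨$⟩ˡ i))) (Perm.flip π) ⟨
        # (λ (k : Fin n) → k Fin.<? (π ⟨$⟩ˡ i)) ≡⟨ #-< (π ⟨$⟩ˡ i) ⟩
        initialPosition i ∎

    excess : ℕ → ℕ
    excess p = hand′ p ∸ leastHand p

    module _ (y : Yields) where
      open Yields y

      leastHand≤ : ∀ {p} → p ≤ m → leastHand p ≤ hand′ p
      leastHand≤ {zero} _ with turned (finalPosition 0) in eq
      ... | 0ℙ = z≤n
      -- A turned card cannot come from hand 0, which is even.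
      ... | 1ℙ with hand′ 0 | trans (parities (finalPosition 0)) eq
      ...   | zero  | ()
      ...   | suc _ | _ = s≤s z≤n
      leastHand≤ {suc p} p<m = ℕ.≤-trans (ℕ.+-monoˡ-≤ _ (leastHand≤ (ℕ.<⇒≤ p<m))) (gaps p<m)

      leastHand+excess : ∀ {p} → p ≤ m → leastHand p + excess p ≡ hand′ p
      leastHand+excess p≤m = ℕ.m+[n∸m]≡n (leastHand≤ p≤m)

      excess-even : ∀ {p} → p ≤ m → parity (excess p) ≡ 0ℙ
      excess-even {p} p≤m = ℙ.+-cancelˡ-≡ (parity (leastHand p)) _ _ (begin
        parity (leastHand p) ℙ.+ parity (excess p) ≡⟨ ℙ.+-homo-+ (leastHand p) (excess p) ⟨
        parity (leastHand p + excess p)            ≡⟨ cong parity (leastHand+excess p≤m) ⟩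
        parity (hand′ p)                           ≡⟨ parities (finalPosition p) ⟩
        turned (finalPosition p)                   ≡⟨ parity-leastHand p ⟨
        parity (leastHand p)                       ≡⟨ ℙ.+-identityʳ _ ⟨
        parity (leastHand p) ℙ.+ 0ℙ                ∎)
        where open ≡-Reasoning

      -- The recursion for `leastHand` meets every gap condition with equality, so subtracting it
      -- leaves plain monotonicity.
      excess-step : ∀ {p} → p < m → excess p ≤ excess (suc p)
      excess-step {p} p<m = ℕ.+-cancelˡ-≤ (leastHand (suc p)) _ _ (begin
        leastHand p + g + excess p ≡⟨ ℕ.+-assoc (leastHand p) g (excess p) ⟩
        leastHand p + (g + excess p) ≡⟨ cong (leastHand p +_) (ℕ.+-comm g (excess p)) ⟩
        leastHand p + (excess p + g) ≡⟨ ℕ.+-assoc (leastHand p) (excess p) g ⟨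
        leastHand p + excess p + g ≡⟨ cong (_+ g) (leastHand+excess (ℕ.<⇒≤ p<m)) ⟩
        hand′ p + g ≤⟨ gaps p<m ⟩
        hand′ (suc p) ≡⟨ leastHand+excess p<m ⟨
        leastHand (suc p) + excess (suc p) ∎)
        where
        open ℕ.≤-Reasoning
        g = gap (turned (finalPosition p)) (turned (finalPosition (suc p))) (finalPosition p) (finalPosition (suc p))

      hand-initial : ∀ i → leastHand (initialPosition i) + excess (initialPosition i) ≡ toℕ (x i)
      hand-initial i = trans (leastHand+excess (initial≤m i)) (cong (toℕ ∘ x) (final-initial i))

  leastHand-step : ∀ p → leastHand p ≤ leastHand (suc p)
  leastHand-step p = ℕ.m≤m+n (leastHand p) _

  -- Even summands preserve the prescribed parities, and weakly increasing ones can only widen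
  -- differences that are already large enough.
  excess⇒yields : ∀ {a} .{{_ : NonZero a}} (x : Vector (Fin a) n) (e : ℕ → ℕ) →
    (∀ {p} → p ≤ m → parity (e p) ≡ 0ℙ) → (∀ {p} → p < m → e p ≤ e (suc p)) →
    (∀ i → toℕ (x i) ≡ leastHand (initialPosition i) + e (initialPosition i)) → Yields x
  excess⇒yields x e even step x≡ = record { parities = parities ; gaps = gaps }
    where
    open ≡-Reasoning
    parities : ∀ i → parity (toℕ (x i)) ≡ turned i
    parities i = begin
      parity (toℕ (x i)) ≡⟨ cong parity (x≡ i) ⟩
      parity (leastHand p + e p) ≡⟨ ℙ.+-homo-+ (leastHand p) (e p) ⟩
      parity (leastHand p) ℙ.+ parity (e p) ≡⟨ cong₂ ℙ._+_ (parity-leastHand p) (even (initial≤m i)) ⟩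
      turned (finalPosition p) ℙ.+ 0ℙ ≡⟨ ℙ.+-identityʳ _ ⟩
      turned (finalPosition p) ≡⟨ cong turned (final-initial i) ⟩
      turned i ∎
      where p = initialPosition i
    x-final : ∀ {p} → p ≤ m → toℕ (x (finalPosition p)) ≡ leastHand p + e p
    x-final p≤m = trans (x≡ _) (cong (λ p → leastHand p + e p) (initial-final (s≤s p≤m)))
    gaps : ∀ {p} → p < m → _ ≤ toℕ (x (finalPosition (suc p)))
    gaps {p} p<m = subst₂ (λ h h′ → h + g ≤ h′) (sym (x-final (ℕ.<⇒≤ p<m))) (sym (x-final p<m))
      (subst (_≤ leastHand (suc p) + e (suc p))
        (trans (ℕ.+-assoc (leastHand p) g (e p)) (trans (cong (leastHand p +_) (ℕ.+-comm g (e p)))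
          (sym (ℕ.+-assoc (leastHand p) (e p) g))))
        (ℕ.+-monoʳ-≤ (leastHand (suc p)) (step p<m)))
      where
      g = gap (turned (finalPosition p)) (turned (finalPosition (suc p))) (finalPosition p) (finalPosition (suc p))

-- Counting by injections

steps⇒≤ : ∀ {f : ℕ → ℕ} {m} → (∀ {p} → p < m → f p ≤ f (suc p)) → ∀ {p q} → p ≤ q → q ≤ m → f p ≤ f q
steps⇒≤ step {q = zero}  z≤n q≤m = ℕ.≤-refl
steps⇒≤ step {q = suc q} p≤q q≤m with ℕ.m≤n⇒m<n∨m≡n p≤q
... | inj₁ (s≤s p≤q′) = ℕ.≤-trans (steps⇒≤ step p≤q′ (ℕ.<⇒≤ q≤m)) (step q≤m)
... | inj₂ refl       = ℕ.≤-refl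

lookup-injective : ∀ {a} {A : Set a} {xs : List A} → Unique≡.Unique xs →
                   ∀ {i j} → lookup xs i ≡ lookup xs j → i ≡ j
lookup-injective (_ ∷ _)      {Fin.zero}  {Fin.zero}  e = refl
lookup-injective (x∉xs ∷ _)   {Fin.zero}  {Fin.suc j} e = contradiction e (All.lookup x∉xs (∈-lookup j))
lookup-injective (x∉xs ∷ _)   {Fin.suc i} {Fin.zero}  e = contradiction (sym e) (All.lookup x∉xs (∈-lookup i))
lookup-injective (_ ∷ xs!)    {Fin.suc i} {Fin.suc j} e = cong Fin.suc (lookup-injective xs! e)

module _ {N p q} {P : Pred (Fin N) p} {Q : Pred (Fin N) q} (P? : Decidable P) (Q? : Decidable Q) where

  -- A pigeonhole argument on the indices of the two filtered lists. The map takes a proof of `P`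
  -- because the excess of a ruffle can be transferred only once the ruffle is known to be a
  -- solution.
  filter-injection : (φ : ∀ {k} → P k → Fin N) → (∀ {k} (h : P k) → Q (φ h)) →
                     (∀ {k l} (h : P k) (h′ : P l) → φ h ≡ φ h′ → k ≡ l) →
                     length (filter P? (allFin N)) ≤ length (filter Q? (allFin N))
  filter-injection φ φ∈Q φ-injective = Fin.injective⇒≤ {f = index} λ {i} {j} e →
    lookup-injective (Unique≡.filter⁺ P? (Unique≡.allFin⁺ N)) (φ-injective (holds i) (holds j)
      (trans (Any.lookup-index (∈Q i)) (trans (cong (lookup (filter Q? (allFin N))) e)
        (sym (Any.lookup-index (∈Q j))))))
    where
    holds : ∀ i → P (lookup (filter P? (allFin N)) i)
    holds i = All.lookup (All.all-filter P? (allFin N)) (∈-lookup i)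
    ∈Q : ∀ i → Any (φ (holds i) ≡_) (filter Q? (allFin N))
    ∈Q i = ∈-filter⁺ Q? (∈-allFin (φ (holds i))) (φ∈Q (holds i))
    index : Fin _ → Fin _
    index i = Any.index (∈Q i)

-- Turns a rational coefficient into a natural number, to which the comparison by injections
-- applies.
∑-indicator : ∀ {a p} {A : Set a} {P : Pred A p} (P? : Decidable P) xs →
              ∑ (λ x → 1ℚ when P? x) xs ≡ length (filter P? xs) copiesOf 1ℚ
∑-indicator P? []       = refl
∑-indicator P? (x ∷ xs) with does (P? x)
... | true  = cong (1ℚ ℚ.+_) (∑-indicator P? xs)
... | false = trans (ℚ.+-identityˡ _) (∑-indicator P? xs)

-- Abstracting the oriented rising number keeps conversion checking from unfolding it.
module Rising {m : ℕ} (μ : DecMonoid.setoid (SignedPermutations (suc m)) ⟶ₛ ≡.setoid ℕ)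
              (μ-minimum : ∀ w → IsMinimum (IsRuffleWith w) (Func.to μ w)) where
  private
    n = suc m

    W : Set
    W = SignedPermutation n

    ν : W → ℕ
    ν = Func.to μ

  excess-bound : ∀ (w : W) {a} .{{_ : NonZero a}} (x : Vector (Fin a) n) → Yields w x →
                 leastHand w m + excess w x m < a
  excess-bound w x y = subst (_< _) (sym (leastHand+excess w x y ℕ.≤-refl)) (Fin.toℕ<n _)

  module _ (w : W) {a : ℕ} .{{_ : NonZero a}} (e : ℕ → ℕ)
           (step : ∀ {p} → p < m → e p ≤ e (suc p)) (bound : leastHand w m + e m < a) where

    private
      bound′ : ∀ {p} → p ≤ m → leastHand w p + e p < a
      -- Both summands increase weakly, so a bound for the last card serves for all.
      bound′ p≤m = ℕ.≤-<-trans (ℕ.+-mono-≤ (steps⇒≤ (λ {p} _ → leastHand-step w p) p≤m ℕ.≤-refl)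
                                            (steps⇒≤ step p≤m ℕ.≤-refl)) bound

    fromExcess : Vector (Fin a) n
    fromExcess i = fromℕ< (bound′ (initial≤m w i))

    toℕ-fromExcess : ∀ i → toℕ (fromExcess i) ≡ leastHand w (initialPosition w i) + e (initialPosition w i)
    toℕ-fromExcess i = Fin.toℕ-fromℕ< (bound′ (initial≤m w i))

    fromExcess-final : ∀ {p} → p ≤ m → toℕ (fromExcess (finalPosition w p)) ≡ leastHand w p + e p
    fromExcess-final p≤m = trans (toℕ-fromExcess _) (cong (λ p → leastHand w p + e p) (initial-final w (s≤s p≤m)))

    fromExcess-yields : (∀ {p} → p ≤ m → parity (e p) ≡ 0ℙ) → Yields w fromExcess
    fromExcess-yields even = excess⇒yields w fromExcess e even step toℕ-fromExcess

  isRuffleWith : ∀ {w : W} {a} (r : Ruffling n) → hands r ≡ a → outcome r ≈ₛ w → IsRuffleWith w a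
  isRuffleWith {w} r hands≡ r≈w = r , hands≡ , subst (λ f → w ≈ₛ f r) outcome≡ (sym ∘ r≈w)

  outcome≈ : ∀ {w : W} {r : Ruffling n} → w ≈ₛ orientedRuffle r → outcome r ≈ₛ w
  outcome≈ {w} {r} w≈r = subst (λ f → f r ≈ₛ w) (sym outcome≡) (sym ∘ w≈r)

  -- Zero excess fits as soon as the least hand of the last card exists, and hands are numbered from
  -- 0, whence the successor. Conversely no ruffle with outcome `w` gives the last card a smaller
  -- hand.
  minimum≡ : ∀ w {k} → IsMinimum (IsRuffleWith w) k → k ≡ suc (leastHand w m)
  minimum≡ w ((ruffling a x , refl , w≈r) , k-least) = ℕ.≤-antisym
    (k-least (suc (leastHand w m)) (isRuffleWith {w} (ruffling (suc (leastHand w m)) x₀) refl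
      (yields⁻ w x₀ (fromExcess-yields w (λ _ → 0) (λ _ → z≤n) bound (λ _ → refl)))))
    (ℕ.≤-<-trans (ℕ.m≤m+n (leastHand w m) _) (excess-bound w x (yields⁺ w x (outcome≈ {w} {ruffling a x} w≈r))))
    where
    bound : leastHand w m + 0 < suc (leastHand w m)
    bound = s≤s (ℕ.≤-reflexive (ℕ.+-identityʳ _))
    x₀ : Vector (Fin (suc (leastHand w m))) n
    x₀ = fromExcess w (λ _ → 0) (λ _ → z≤n) bound

  risingNumber≡ : ∀ w → ν w ≡ suc (leastHand w m)
  risingNumber≡ w = minimum≡ w (μ-minimum w)

  -- With exactly `ν w` hands the last card has no room for excess, and by monotonicity neither has
  -- any other card.
  yields-unique : ∀ w {a} .{{_ : NonZero a}} (x x′ : Vector (Fin a) n) → a ≡ ν w →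
                  Yields w x → Yields w x′ → ∀ i → toℕ (x i) ≡ toℕ (x′ i)
  yields-unique w x x′ a≡ y y′ i = trans (least x y) (sym (least x′ y′))
    where
    least : ∀ x → Yields w x → toℕ (x i) ≡ leastHand w (initialPosition w i)
    least x y = trans (sym (hand-initial w x y i)) (trans
      (cong (leastHand w (initialPosition w i) +_) (ℕ.n≤0⇒n≡0 (ℕ.≤-trans
        (steps⇒≤ (excess-step w x y) (initial≤m w i) ℕ.≤-refl)
        (ℕ.+-cancelˡ-≤ (leastHand w m) _ _ (ℕ.≤-pred (ℕ.≤-trans (excess-bound w x y)
          (ℕ.≤-reflexive (trans a≡ (trans (risingNumber≡ w) (cong suc (sym (ℕ.+-identityʳ _))))))))))))
      (ℕ.+-identityʳ _))

  module _ (w v : W) (ν≡ : ν w ≡ ν v) {a : ℕ} .{{_ : NonZero a}} where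

    private
      translate-bound : ∀ (x : Vector (Fin a) n) → Yields w x → leastHand v m + excess w x m < a
      translate-bound x y = subst (λ l → l + excess w x m < a)
        (ℕ.suc-injective (trans (sym (risingNumber≡ w)) (trans ν≡ (risingNumber≡ v)))) (excess-bound w x y)

    -- Keeps the excess and exchanges the least hands of `w` for those of `v`. Equal rising numbers
    -- mean equal least hands of the last card, so the result still fits into `a` hands.
    translate : (x : Vector (Fin a) n) → Yields w x → Vector (Fin a) n
    translate x y = fromExcess v (excess w x) (excess-step w x y) (translate-bound x y)

    translate-yields : ∀ x y → Yields v (translate x y)
    translate-yields x y =
      fromExcess-yields v (excess w x) (excess-step w x y) (translate-bound x y) (excess-even w x y)

    translate-injective : ∀ x x′ y y′ → (∀ i → translate x y i ≡ translate x′ y′ i) →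
                          ∀ i → toℕ (x i) ≡ toℕ (x′ i)
    translate-injective x x′ y y′ eq i = begin
      toℕ (x i)                         ≡⟨ hand-initial w x y i ⟨
      -- The excess at `p` is visible where `v`, not `w`, puts the card from `p`.
      leastHand w p + excess w x p      ≡⟨ cong (leastHand w p +_) (ℕ.+-cancelˡ-≡ (leastHand v p) _ _ (begin
          leastHand v p + excess w x p
            ≡⟨ fromExcess-final v (excess w x) (excess-step w x y) (translate-bound x y) (initial≤m w i) ⟨
          toℕ (translate x y (finalPosition v p))
            ≡⟨ cong toℕ (eq (finalPosition v p)) ⟩
          toℕ (translate x′ y′ (finalPosition v p))
            ≡⟨ fromExcess-final v (excess w x′) (excess-step w x′ y′) (translate-bound x′ y′) (initial≤m w i) ⟩
          leastHand v p + excess w x′ p               ∎)) ⟩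
      leastHand w p + excess w x′ p     ≡⟨ hand-initial w x′ y′ i ⟩
      toℕ (x′ i)                        ∎
      where
      open ≡-Reasoning
      p = initialPosition w i

  private
    module W where
      open MonoidAlgebra (SignedPermutations n) public
      open Properties (SignedPermutations n) public
    module R where
      open MonoidAlgebra (Ruffles n) public
      open Properties (Ruffles n) public
    imageOfHandSum : Ruffling n → W.ℚ[_]
    imageOfHandSum r = image (Ruffles n) (SignedPermutations n) outcome (handSum r)

  -- Coefficients of the images of hand sums

  module _ (a : ℕ) .{{_ : NonZero a}} where

    outcome? : (w : W) → Decidable (λ k → outcome (nth a k) ≈ₛ w)
    outcome? w k = outcome (nth a k) ≟ₛ w

    multiplicity : W → ℕ
    multiplicity w = length (filter (outcome? w) (allFin (a ^ n)))

    private
      yields : ∀ (w : W) (k : Fin (a ^ n)) → outcome (nth a k) ≈ₛ w → Yields w {a} (finToFun k)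
      yields w k = yields⁺ w (finToFun k)

      outcome-nth : ∀ (w : W) (x : Vector (Fin a) n) → Yields w x → outcome (nth a (funToFin x)) ≈ₛ w
      outcome-nth w x y c = trans
        (outcome-cong {r = nth a (funToFin x)} {ruffling a x} (refl , λ i → cong toℕ (Fin.finToFun-funToFin x i)) c)
        (yields⁻ w x y c)

    multiplicity-≤ : ∀ w v → ν w ≡ ν v → multiplicity w ≤ multiplicity v
    multiplicity-≤ w v ν≡ = filter-injection (outcome? w) (outcome? v)
      (λ {k} h → funToFin (translate w v ν≡ (finToFun k) (yields w k h)))
      (λ {k} h → outcome-nth v (translate w v ν≡ (finToFun k) (yields w k h))
        (translate-yields w v ν≡ (finToFun k) (yields w k h)))
      (λ {k} {l} h h′ e → nth-injective a (refl ,
        translate-injective w v ν≡ (finToFun k) (finToFun l) (yields w k h) (yields w l h′)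
        (funToFin-injective e)))
      where
      funToFin-injective : ∀ {x x′ : Vector (Fin a) n} → funToFin x ≡ funToFin x′ → ∀ i → x i ≡ x′ i
      funToFin-injective {x} {x′} e i = trans (sym (Fin.finToFun-funToFin x i))
        (trans (cong (λ f → finToFun f i) e) (Fin.finToFun-funToFin x′ i))

    multiplicity-cong : ∀ w v → ν w ≡ ν v → multiplicity w ≡ multiplicity v
    multiplicity-cong w v ν≡ = ℕ.≤-antisym (multiplicity-≤ w v ν≡) (multiplicity-≤ v w (sym ν≡))

    private
      rufflesImage = image (Ruffles n) (SignedPermutations n) outcome (R.monomials (ruffles a))

    coefficient-ruffles-∑ : ∀ w → W.coefficient rufflesImage w ≡ ∑ (λ k → 1ℚ when outcome? w k) (allFin (a ^ n))
    coefficient-ruffles-∑ w = begin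
      W.coefficient (map (map₂ outcome) (map (1ℚ ,_) (map (nth a) ks))) w
        ≡⟨ cong (λ u → W.coefficient u w) (outcomes ks) ⟩
      W.coefficient (W.monomials (map (λ k → outcome (nth a k)) ks)) w
        ≡⟨ W.coefficient-monomials (map (λ k → outcome (nth a k)) ks) w ⟩
      ∑ (λ v → 1ℚ when v ≟ₛ w) (map (λ k → outcome (nth a k)) ks)
        ≡⟨ ∑-map (λ v → 1ℚ when v ≟ₛ w) (λ k → outcome (nth a k)) ks ⟩
      ∑ (λ k → 1ℚ when outcome? w k) ks ∎
      where
      open ≡-Reasoning
      ks : List (Fin (a ^ n))
      ks = allFin (a ^ n)
      outcomes : ∀ ks → map (map₂ outcome) (map (1ℚ ,_) (map (nth a) ks))
                     ≡ W.monomials (map (λ k → outcome (nth a k)) ks)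
      outcomes []       = refl
      outcomes (k ∷ ks) = cong ((1ℚ , outcome (nth a k)) ∷_) (outcomes ks)

    coefficient-ruffles-constant : ∀ w v → ν w ≡ ν v →
                                   W.coefficient rufflesImage w ≡ W.coefficient rufflesImage v
    coefficient-ruffles-constant w v ν≡ = trans (value w) (trans
      (cong (_copiesOf 1ℚ) (multiplicity-cong w v ν≡)) (sym (value v)))
      where
      value : ∀ w → W.coefficient rufflesImage w ≡ multiplicity w copiesOf 1ℚ
      value w = trans (coefficient-ruffles-∑ w) (∑-indicator (outcome? w) (allFin (a ^ n)))

    coefficient-ruffles-> : ∀ w → a < ν w → W.coefficient rufflesImage w ≡ 0ℚ
    coefficient-ruffles-> w a<ν = trans (coefficient-ruffles-∑ w) (∑-zero (allFin (a ^ n))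
      (All.tabulate λ {k} _ → when-false (outcome? w k) λ h →
        ℕ.<⇒≱ a<ν (proj₂ (μ-minimum w) a (isRuffleWith {w} (nth a k) refl h))))

    -- The witness of minimality supplies one ruffle with outcome `w`, and `yields-unique` excludes
    -- a second, so a single term of the sum survives.
    coefficient-ruffles-≡ : ∀ w → a ≡ ν w → W.coefficient rufflesImage w ≡ 1ℚ
    coefficient-ruffles-≡ w a≡ν = trans (coefficient-ruffles-∑ w) (trans
      (∑-cong (λ k → when-⇔ (outcome? w k) (k Fin.≟ k₀) unique (λ { refl → k₀∈ }) 1ℚ) (allFin (a ^ n)))
      (∑-unique (≡.decSetoid Fin._≟_) (λ _ → 1ℚ) (λ _ → refl) k₀ (Unique≡.allFin⁺ (a ^ n)) (∈-allFin k₀)))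
      where
      hasOutcome : ∀ {b} → a ≡ b → IsRuffleWith w b → ∃ λ k → outcome (nth a k) ≈ₛ w
      hasOutcome a≡b (r , hands≡b , w≈r) = proj₁ r∈ , λ c →
        trans (sym (outcome-cong {r = r} {nth a (proj₁ r∈)} (proj₂ r∈) c)) (outcome≈ {w} {r} w≈r c)
        where r∈ = nth-surjective a r (trans hands≡b (sym a≡b))
      solution : ∃ λ k → outcome (nth a k) ≈ₛ w
      solution = hasOutcome a≡ν (proj₁ (μ-minimum w))
      k₀ : Fin (a ^ n)
      k₀ = proj₁ solution
      k₀∈ : outcome (nth a k₀) ≈ₛ w
      k₀∈ = proj₂ solution
      unique : ∀ {k} → outcome (nth a k) ≈ₛ w → k ≡ k₀
      unique {k} h = nth-injective a (refl ,
        yields-unique w (finToFun k) (finToFun k₀) a≡ν (yields w k h) (yields w k₀ k₀∈))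

  outcomes-complete : ∀ a .{{_ : NonZero a}} (w : W) → IsRuffleWith w a → Any (w ≈ₛ_) (map outcome (ruffles a))
  outcomes-complete a w (r , hands≡ , w≈r) = Any.map⁺ (Any.map
    (λ {s} r≈s c → trans (sym (outcome≈ {w} {r} w≈r c)) (outcome-cong {r = r} {s} r≈s c)) (∈-ruffles⁺ a r hands≡))

  -- The outcomes of the ruffles with `n * 2` hands exhaust the group, by `dealOneByOne`;
  -- repetitions are removed afterwards.
  risingClasses : W.HasFiniteClasses μ
  risingClasses = W.finite⇒finiteClasses ℕ.≡-decSetoid μ (map outcome (ruffles (n * 2)))
    (λ w → outcomes-complete (n * 2) w (dealOneByOne w))

  coefficient-image-constant : ∀ r {w v} → ν w ≡ ν v →
                               W.coefficient (imageOfHandSum r) w ≡ W.coefficient (imageOfHandSum r) v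
  coefficient-image-constant (ruffling a _) {w} {v} = coefficient-ruffles-constant a w v

  coefficient-image-> : ∀ r w → hands r < ν w → W.coefficient (imageOfHandSum r) w ≡ 0ℚ
  coefficient-image-> (ruffling a _) = coefficient-ruffles-> a

  coefficient-image-≡ : ∀ r w → hands r ≡ ν w → W.coefficient (imageOfHandSum r) w ≡ 1ℚ
  coefficient-image-≡ (ruffling a _) = coefficient-ruffles-≡ a

  -- Triangularity and the rising algebra

  module _ (finite : W.HasFiniteClasses μ) where
    private
      risingSum : W → W.ℚ[_]
      risingSum = W.classSum μ finite

      open module Classes = W.Classes ℕ.≡-decSetoid μ finite using (coefficient-classSum; constant⇒member)

    image∈Span : ∀ r → imageOfHandSum r ∈ W.Span risingSum
    image∈Span r = constant⇒member (W.Span-isSubspace risingSum) (imageOfHandSum r)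
      (λ {w} {v} → coefficient-image-constant r {w} {v}) (λ w → inj₂ (W.generator∈Span risingSum w))

    -- The unitriangular system is inverted by strong induction on `ν w`. Take a ruffle `r` with
    -- `ν w` hands: its image sum minus the class sum of `w` involves only classes of smaller rising
    -- number.
    risingSum∈Span : ∀ w → risingSum w ∈ W.Span imageOfHandSum
    risingSum∈Span w = go (suc (ν w)) w ℕ.≤-refl
      where
      module S = W.IsSubspace (W.Span-isSubspace imageOfHandSum)
      step : ∀ w r → hands r ≡ ν w → (∀ v → ν v < ν w → risingSum v ∈ W.Span imageOfHandSum) →
             risingSum w ∈ W.Span imageOfHandSum
      step w r hands≡ smaller = S.respects {imageOfHandSum r W.⊕ (ℚ.- 1ℚ) W.· u} {risingSum w} W.⌈ recover ⌉
        (S.⊕-closed {imageOfHandSum r} (W.generator∈Span imageOfHandSum r) (S.·-closed (ℚ.- 1ℚ) {u} u∈))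
        where
        u : W.ℚ[_]
        u = imageOfHandSum r W.⊕ (ℚ.- 1ℚ) W.· risingSum w
        u-value : ∀ v → W.coefficient u v ≡ W.coefficient (imageOfHandSum r) v ℚ.- W.coefficient (risingSum w) v
        u-value v = trans (W.coefficient-⊕ (imageOfHandSum r) ((ℚ.- 1ℚ) W.· risingSum w) v)
          (cong (W.coefficient (imageOfHandSum r) v ℚ.+_)
            (trans (W.coefficient-· (ℚ.- 1ℚ) (risingSum w) v) (minus (W.coefficient (risingSum w) v))))
          where
          minus : ∀ q → (ℚ.- 1ℚ) ℚ.* q ≡ ℚ.- q
          minus q = trans (sym (ℚ.neg-distribˡ-* 1ℚ q)) (cong ℚ.-_ (ℚ.*-identityˡ q))
        u-constant : ∀ {v v′} → ν v ≡ ν v′ → W.coefficient u v ≡ W.coefficient u v′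
        u-constant {v} {v′} e = trans (u-value v) (trans
          (cong₂ ℚ._-_ (coefficient-image-constant r {v} {v′} e) (trans (coefficient-classSum w v)
            (trans (when-⇔ (ν w ℕ.≟ ν v) (ν w ℕ.≟ ν v′) (λ h → trans h e) (λ h → trans h (sym e)) 1ℚ)
              (sym (coefficient-classSum w v′)))))
          (sym (u-value v′)))
        cases : ∀ v → W.coefficient u v ≡ 0ℚ ⊎ risingSum v ∈ W.Span imageOfHandSum
        cases v = compare (ℕ.<-cmp (ν v) (ν w))
          where
          compare : Tri (ν v < ν w) (ν v ≡ ν w) (ν v > ν w) →
                    W.coefficient u v ≡ 0ℚ ⊎ risingSum v ∈ W.Span imageOfHandSum
          compare (tri< l _ _) = inj₂ (smaller v l)
          -- On the class of `w` both coefficients are 1; on classes of larger rising number both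
          -- are 0.
          compare (tri≈ _ e _) = inj₁ (trans (u-value v)
            (cong₂ ℚ._-_ (coefficient-image-≡ r v (trans hands≡ (sym e)))
            (trans (coefficient-classSum w v) (when-true (ν w ℕ.≟ ν v) (sym e)))))
          compare (tri> _ ¬e g) = inj₁ (trans (u-value v)
            (cong₂ ℚ._-_ (coefficient-image-> r v (subst (_< ν v) (sym hands≡) g))
            (trans (coefficient-classSum w v) (when-false (ν w ℕ.≟ ν v) (¬e ∘ sym)))))
        u∈ : u ∈ W.Span imageOfHandSum
        u∈ = constant⇒member (W.Span-isSubspace imageOfHandSum) u (λ {v} {v′} → u-constant {v} {v′}) cases
        -- Subtracting the difference `u` from the image sum gives back the class sum of `w`.
        cancel : ∀ i c → i ℚ.+ (ℚ.- 1ℚ) ℚ.* (i ℚ.- c) ≡ c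
        cancel = solve 2 (λ i c → i :+ (:- con 1ℚ) :* (i :- c) := c) refl
          where open +-*-Solver
        recover : ∀ v → W.coefficient (imageOfHandSum r W.⊕ (ℚ.- 1ℚ) W.· u) v ≡ W.coefficient (risingSum w) v
        recover v = trans (W.coefficient-⊕ (imageOfHandSum r) ((ℚ.- 1ℚ) W.· u) v) (trans
          (cong (W.coefficient (imageOfHandSum r) v ℚ.+_)
            (trans (W.coefficient-· (ℚ.- 1ℚ) u v) (cong ((ℚ.- 1ℚ) ℚ.*_) (u-value v))))
          (cancel (W.coefficient (imageOfHandSum r) v) (W.coefficient (risingSum w) v)))
      go : ∀ b w → ν w < b → risingSum w ∈ W.Span imageOfHandSum
      go (suc b) w (s≤s νw≤b) = step w (proj₁ r∈) (proj₁ (proj₂ r∈)) (λ v l → go b v (ℕ.<-≤-trans l νw≤b))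
        where r∈ = proj₁ (μ-minimum w)

    doesTheRightThing : DoesTheRightThing (Ruffles n) (SignedPermutations n) (hand n) μ outcome
    doesTheRightThing = record
      { isHomomorphism = outcome-isHomomorphism
      ; isLumping      = hand-isLumping
      ; finite         = finite
      ; belong         = image∈Span
      ; span           = λ {u} → Span⊆ {u}
      }
      where
      Span⊆ : W.Span risingSum ⊆ W.Span imageOfHandSum
      Span⊆ {u} = W.Span-minimal (W.Span-isSubspace imageOfHandSum) risingSum∈Span {u}

    private
      image-product : ∀ r s → imageOfHandSum r W.⊗ imageOfHandSum s W.≐ imageOfHandSum (r ∙ᵣ s)
      image-product r s = W.≐-trans
        (W.≐-sym (image-⊗ (Ruffles n) (SignedPermutations n) outcome (λ {r} {s} → outcome-cong {r = r} {s})
          (IsMonoidHomomorphism.homo outcome-isHomomorphism) (handSum r) (handSum s)))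
        (image-cong (Ruffles n) (SignedPermutations n) outcome (λ {r} {s} → outcome-cong {r = r} {s})
          (handSum-⊗ r s))

      image-comm : ∀ r s → imageOfHandSum r W.⊗ imageOfHandSum s W.≐ imageOfHandSum s W.⊗ imageOfHandSum r
      image-comm r s = W.≐-trans (image-product r s) (W.≐-trans
        (image-cong (Ruffles n) (SignedPermutations n) outcome (λ {r} {s} → outcome-cong {r = r} {s})
          (handSum-comm r s))
        (W.≐-sym (image-product s r)))

      Span-image⊆ : W.Span imageOfHandSum ⊆ W.Span risingSum
      Span-image⊆ {u} = W.Span-minimal (W.Span-isSubspace risingSum) image∈Span {u}

      image-closed : ∀ {u v} → u ∈ W.Span imageOfHandSum → v ∈ W.Span imageOfHandSum → u W.⊗ v ∈ W.Span imageOfHandSum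
      image-closed {u} {v} = W.IsSubalgebra.⊗-closed (W.Span-isSubalgebra imageOfHandSum λ r s →
        W.IsSubspace.respects (W.Span-isSubspace imageOfHandSum) (W.≐-sym (image-product r s))
          (W.generator∈Span imageOfHandSum (r ∙ᵣ s))) {u} {v}

    -- A product rule is at hand only for the image sums, so class sums are rewritten in terms of
    -- these, multiplied there, and brought back through the common span.
    risingAlgebra : W.IsLumping μ
    risingAlgebra = Classes.Span-isLumping λ w v → Span-image⊆ {risingSum w W.⊗ risingSum v}
      (image-closed {risingSum w} {risingSum v} (risingSum∈Span w) (risingSum∈Span v))

    risingAlgebra-commutative : W.Commutative (W.Span risingSum)
    risingAlgebra-commutative {u} {v} u∈ v∈ =
      W.Span-commutative imageOfHandSum image-comm {u} {v} (⊆′ {u} u∈) (⊆′ {v} v∈)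
      where
      ⊆′ : W.Span risingSum ⊆ W.Span imageOfHandSum
      ⊆′ {u} = W.Span-minimal (W.Span-isSubspace imageOfHandSum) risingSum∈Span {u}

mainTheorem2 : ∀ (n : ℕ) → n ≥ 1 →
    let open MonoidAlgebra (SignedPermutations n) in
    DoesTheRightThing (Ruffles n) (SignedPermutations n)
    (hand n) (orientedRisingNumber n) orientedRuffle
    × Σ[ L ∈ IsLumping (orientedRisingNumber n) ] Commutative (IsLumping.Subalgebra L)
mainTheorem2 (suc m) _ =
  subst (DoesTheRightThing (Ruffles (suc m)) (SignedPermutations (suc m))
           (hand (suc m)) (orientedRisingNumber (suc m)))
    outcome≡ (doesTheRightThing risingClasses)
  , risingAlgebra risingClasses
  , λ {u} {v} → risingAlgebra-commutative risingClasses {u = u} {v}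
  where open Rising (orientedRisingNumber (suc m)) (λ w → proj₂ (orientedRising w))
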